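{- Let $d\ge 2$ be an integer and let $$y(d)=\frac{((2d-2)!)^d}{N(d)\binom{2d-2}{d}\binom{2d-2}{d-1}\left( 2((d-1)!)^d-(d-1)^2\left( d-1+\frac1d\right)((d-2)!)^d\right)}.$$ Then for every positive integer $t$ with $t>y(d)\cdot d\log\left((2d-2)!\right)$, we have $\chi_c^\star(K_{d,t})\ge 2d-1$.
   Context: $K_{d,t}$ is the complete bipartite graph with parts of sizes $d$ and $t$. $N(d)$ denotes the number of Latin squares of order $d$ (i.e. $d\times d$ arrays with entries from $\{1,\dots,d\}$ in which every row and every column has distinct entries), and $\log$ is the natural logarithm. For a graph $G$ and a positive integer $k$, a $k$-fold correspondence-cover of $G$ is a graph $H$ whose vertex set is partitioned into sets $L(v)=\{1_v,\dots,k_v\}$, $v\in V(G)$, such that each $L(v)$ is independent in $H$, there are no edges of $H$ between $L(u)$ and $L(v)$ when $uv\notin E(G)$, and for every edge $uv\in E(G)$ the edges of $H$ between $L(u)$ and $L(v)$ form a matching. A correspondence-colouring of $H$ is an independent set of $H$ containing exactly one vertex of each $L(v)$. A correspondence-packing of $H$ is a collection of $k$ pairwise disjoint correspondence-colourings of $H$. The correspondence packing number $\chi_c^\star(G)$ is the least $k$ such that every $k$-fold correspondence-cover of $G$ admits a correspondence-packing. -}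

module Defs where

open import Data.Nat as ℕ using (ℕ; zero; suc; _∸_)
open import Data.Nat.Properties using (_!≢0)
open import Data.Nat.Combinatorics using (_C_)
open import Data.Nat.Base using (_!)
open import Data.Integer using (+_)
open import Data.Rational as ℚ using (ℚ; _/_; 0ℚ; 1ℚ)
open import Data.Fin using (Fin)
open import Data.Fin.Properties using () renaming (_≟_ to _≟F_)
open import Data.Vec using (Vec; []; _∷_; lookup)
open import Data.List as List using (List; []; _∷_; allFin; concatMap; filter; length)
open import Data.Bool using (Bool; true; false; _∨_; not)
open import Data.Sum using (_⊎_; inj₁; inj₂)
open import Data.Product using (Σ; _×_; ∃; ∃-syntax)
open import Data.Unit using (⊤)
open import Data.Empty using (⊥)
open import Relation.Nullary using (¬_; does)
open import Relation.Binary.PropositionalEquality using (_≡_)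
open import Relation.Nullary.Decidable using (⌊_⌋)

record Graph : Set₁ where
  field
    V   : Set
    Adj : V → V → Set

open Graph public

Adj-K : (d t : ℕ) → Fin d ⊎ Fin t → Fin d ⊎ Fin t → Set
Adj-K d t (inj₁ _) (inj₁ _) = ⊥
Adj-K d t (inj₁ _) (inj₂ _) = ⊤
Adj-K d t (inj₂ _) (inj₁ _) = ⊤
Adj-K d t (inj₂ _) (inj₂ _) = ⊥

K : ℕ → ℕ → Graph
K d t = record { V = Fin d ⊎ Fin t ; Adj = Adj-K d t }

-- Correspondence covers.  The vertex i_v of H is represented by (v , i),
-- i : Fin k; the edge relation of H is E u i v j.

record Cover (G : Graph) (k : ℕ) : Set₁ where
  field
    E          : V G → Fin k → V G → Fin k → Set
    symmetric  : ∀ u i v j → E u i v j → E v j u i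
    indep      : ∀ v i j → ¬ E v i v j
    nonadj     : ∀ u i v j → ¬ Adj G u v → ¬ E u i v j
    matching   : ∀ u i v j j′ → Adj G u v → E u i v j → E u i v j′ → j ≡ j′

open Cover public

IsColouring : {G : Graph} {k : ℕ} → Cover G k → (V G → Fin k) → Set
IsColouring {G} H c = ∀ u v → ¬ E H u (c u) v (c v)

HasPacking : {G : Graph} {k : ℕ} → Cover G k → Set
HasPacking {G} {k} H =
  Σ (Fin k → V G → Fin k) λ c →
    (∀ a → IsColouring H (c a)) ×
    (∀ a b → ¬ a ≡ b → ∀ v → ¬ c a v ≡ c b v)

PackingProperty : Graph → ℕ → Set₁
PackingProperty G k = (H : Cover G k) → HasPacking H

χc⋆≥ : Graph → ℕ → Set₁
χc⋆≥ G m = ∀ k → 1 ℕ.≤ k → PackingProperty G k → m ℕ.≤ k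

Square : ℕ → Set
Square d = Vec (Vec (Fin d) d) d

allVecs : {A : Set} → List A → (n : ℕ) → List (Vec A n)
allVecs xs zero    = [] ∷ []
allVecs xs (suc n) = concatMap (λ x → List.map (x ∷_) (allVecs xs n)) xs

allSquares : (d : ℕ) → List (Square d)
allSquares d = allVecs (allVecs (allFin d) d) d

allB : {A : Set} → List A → (A → Bool) → Bool
allB xs p = List.foldr (λ x b → p x ∧′′ b) true xs
  where
    _∧′′_ : Bool → Bool → Bool
    true  ∧′′ b = b
    false ∧′′ _ = false

entry : {d : ℕ} → Square d → Fin d → Fin d → Fin d
entry s i j = lookup (lookup s i) j

isLatin : {d : ℕ} → Square d → Bool
isLatin {d} s =
  allB (allFin d) λ i → allB (allFin d) λ j → allB (allFin d) λ j′ →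
    ⌊ j ≟F j′ ⌋ ∨
    (not ⌊ entry s i j ≟F entry s i j′ ⌋ ∧′ not ⌊ entry s j i ≟F entry s j′ i ⌋)
  where
    _∧′_ : Bool → Bool → Bool
    true  ∧′ b = b
    false ∧′ _ = false

NLatin : ℕ → ℕ
NLatin d = length (List.filter (λ s → isLatin s Data.Bool.≟ true) (allSquares d))

ℕ→ℚ : ℕ → ℚ
ℕ→ℚ n = + n / 1

_^ℚ_ : ℚ → ℕ → ℚ
p ^ℚ zero  = 1ℚ
p ^ℚ suc n = p ℚ.* (p ^ℚ n)

inv! : ℕ → ℚ
inv! k = (+ 1 / (k !)) {{k !≢0}}

expPartial : ℚ → ℕ → ℚ
expPartial r zero    = 1ℚ
expPartial r (suc n) = expPartial r n ℚ.+ (r ^ℚ suc n) ℚ.* inv! (suc n)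

-- log M < r  (for r > 0 this is  M < e^r, and since the partial sums of the
-- exponential series increase strictly to e^r, this holds iff some partial sum exceeds M)
LogLt : ℕ → ℚ → Set
LogLt M r = (0ℚ ℚ.< r) × ∃[ n ] (ℕ→ℚ M ℚ.< expPartial r n)

yNum : ℕ → ℚ
yNum d = ℕ→ℚ (((2 ℕ.* d ∸ 2) !) ℕ.^ d)

yFactor : ℕ → ℚ
yFactor zero    = 0ℚ   -- unused (d ≥ 2)
yFactor (suc e) =
  ℕ→ℚ 2 ℚ.* ℕ→ℚ ((e !) ℕ.^ suc e)
    ℚ.- ℕ→ℚ (e ℕ.* e) ℚ.* (ℕ→ℚ e ℚ.+ + 1 / suc e) ℚ.* ℕ→ℚ (((e ∸ 1) !) ℕ.^ suc e)

yDen : ℕ → ℚ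
yDen d = ℕ→ℚ (NLatin d ℕ.* ((2 ℕ.* d ∸ 2) C d) ℕ.* ((2 ℕ.* d ∸ 2) C (d ∸ 1))) ℚ.* yFactor d

-- t > y(d) · d · log((2d-2)!).  Since y(d) · d > 0, this is equivalent to: there is a
-- rational r with log((2d-2)!) < r and y(d) · d · r < t; the latter is written with the
-- (positive) denominator of y(d) cleared:  yNum d · d · r < t · yDen d.
AboveThreshold : ℕ → ℕ → Set
AboveThreshold d t =
  ∃[ r ] (LogLt ((2 ℕ.* d ∸ 2) !) r × (yNum d ℚ.* ℕ→ℚ d ℚ.* r ℚ.< ℕ→ℚ t ℚ.* yDen d))

{-# OPTIONS --safe #-}
module Submission where

-- Take 2d − 2 colours (monotonicity in the number of colours covers the smaller values) and let each
-- of the t vertices contribute d random permutations.  A packing fixes d permutations on the side of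
-- size d, and a vertex on the other side extends it iff a certain d × (2d − 2) array of permutations
-- admits a further row avoiding all its columns.  Call an array bad if it does not.  If B of the
-- T = ((2d − 2)!)^d arrays are bad, some choice defeats all packings as soon as
-- T (1 − B/T)^t < 1, which follows from t B/T > d log (2d − 2)!.
--
-- For the bound on B, an array is bad if e = d − 1 symbols Q occur in each of d columns P (a tight
-- pair), or if the same holds for the array of inverse permutations.  Tight pairs are counted
-- through Latin squares of order d.  Multiple counting is corrected by weights: an array whose tight
-- pair completes to a Latin square has up to d tight pairs, of weight 1 each; a pair which may
-- coexist with a tight pair of the inverse array has weight d; the other pairs have weight 2d.  Then
-- an array and its inverse have total weight at most 2d.

open import Defs

-- Rational estimates for partial sums of the exponential series.

module ExponentialBound where

  open import Data.Nat as ℕ using (ℕ; zero; suc)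
  open import Data.Nat.Base using (_!)
  import Data.Nat.Properties as ℕ
  open import Data.Nat.Properties using (_!≢0)
  open import Data.Integer as ℤ using (+_)
  import Data.Integer.Properties as ℤ
  open import Data.Rational
  open import Data.Rational.Properties
  open import Data.Rational.Unnormalised as ℚᵘ using (mkℚᵘ; *≡*; *≤*; *<*)
  import Data.Rational.Unnormalised.Properties as ℚᵘ
  open import Data.Rational.Solver
  open +-*-Solver
  open import Relation.Binary.PropositionalEquality hiding (J)

  open ≤-Reasoning

  *-mono : ∀ {p q} r → 0ℚ ≤ r → p ≤ q → r * p ≤ r * q
  *-mono r 0≤r = *-monoˡ-≤-nonNeg r {{nonNegative 0≤r}}

  *-monoᵣ : ∀ {p q} r → 0ℚ ≤ r → p ≤ q → p * r ≤ q * r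
  *-monoᵣ r 0≤r = *-monoʳ-≤-nonNeg r {{nonNegative 0≤r}}

  *-mono₂ : ∀ {p q r s} → 0ℚ ≤ p → 0ℚ ≤ s → p ≤ q → r ≤ s → p * r ≤ q * s
  *-mono₂ {p} {q} {r} {s} 0≤p 0≤s p≤q r≤s = ≤-trans (*-mono p 0≤p r≤s) (*-monoᵣ s 0≤s p≤q)

  0≤* : ∀ {p q} → 0ℚ ≤ p → 0ℚ ≤ q → 0ℚ ≤ p * q
  0≤* {p} {q} 0≤p 0≤q = nonNegative⁻¹ _ {{nonNeg*nonNeg⇒nonNeg p
      {{nonNegative 0≤p}} q {{nonNegative 0≤q}}}}

  0<* : ∀ {p q} → 0ℚ < p → 0ℚ < q → 0ℚ < p * q
  0<* {p} {q} 0<p 0<q = positive⁻¹ _ {{pos*pos⇒pos p {{positive 0<p}} q {{positive 0<q}}}}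

  0≤+ : ∀ {p q} → 0ℚ ≤ p → 0ℚ ≤ q → 0ℚ ≤ p + q
  0≤+ = +-mono-≤

  0≤- : ∀ {p q} → p ≤ q → 0ℚ ≤ q - p
  0≤- {p} {q} p≤q = subst (_≤ q - p) (+-inverseʳ p) (+-monoˡ-≤ (- p) p≤q)

  0<- : ∀ {p q} → p < q → 0ℚ < q - p
  0<- {p} {q} p<q = subst (_< q - p) (+-inverseʳ p) (+-monoˡ-< (- p) p<q)

  toℚᵘ-ℕ→ℚ : ∀ n → toℚᵘ (ℕ→ℚ n) ℚᵘ.≃ mkℚᵘ (+ n) 0
  toℚᵘ-ℕ→ℚ n = toℚᵘ-fromℚᵘ (mkℚᵘ (+ n) 0)

  ℕ→ℚ-+ : ∀ m n → ℕ→ℚ (m ℕ.+ n) ≡ ℕ→ℚ m + ℕ→ℚ n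
  ℕ→ℚ-+ m n = toℚᵘ-injective (ℚᵘ.≃-trans (toℚᵘ-ℕ→ℚ (m ℕ.+ n)) (ℚᵘ.≃-sym
    (ℚᵘ.≃-trans (toℚᵘ-homo-+ (ℕ→ℚ m) (ℕ→ℚ n))
      (ℚᵘ.≃-trans (ℚᵘ.+-cong (toℚᵘ-ℕ→ℚ m) (toℚᵘ-ℕ→ℚ n))
        (*≡* (cong (ℤ._* + 1) (cong₂ ℤ._+_ (ℤ.*-identityʳ (+ m)) (ℤ.*-identityʳ (+ n)))))))))

  ℕ→ℚ-* : ∀ m n → ℕ→ℚ (m ℕ.* n) ≡ ℕ→ℚ m * ℕ→ℚ n
  ℕ→ℚ-* m n = toℚᵘ-injective (ℚᵘ.≃-trans (toℚᵘ-ℕ→ℚ (m ℕ.* n)) (ℚᵘ.≃-sym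
    (ℚᵘ.≃-trans (toℚᵘ-homo-* (ℕ→ℚ m) (ℕ→ℚ n))
      (ℚᵘ.≃-trans (ℚᵘ.*-cong (toℚᵘ-ℕ→ℚ m) (toℚᵘ-ℕ→ℚ n))
        (*≡* (cong (ℤ._* + 1) (sym (ℤ.pos-* m n))))))))

  ℕ→ℚ-^ : ∀ m n → ℕ→ℚ (m ℕ.^ n) ≡ ℕ→ℚ m ^ℚ n
  ℕ→ℚ-^ m zero    = refl
  ℕ→ℚ-^ m (suc n) = trans (ℕ→ℚ-* m (m ℕ.^ n)) (cong (ℕ→ℚ m *_) (ℕ→ℚ-^ m n))

  ℕ→ℚ-mono-≤ : ∀ {m n} → m ℕ.≤ n → ℕ→ℚ m ≤ ℕ→ℚ n
  ℕ→ℚ-mono-≤ {m} {n} m≤n = toℚᵘ-cancel-≤ (ℚᵘ.≤-respˡ-≃ (ℚᵘ.≃-sym (toℚᵘ-ℕ→ℚ m))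
    (ℚᵘ.≤-respʳ-≃ (ℚᵘ.≃-sym (toℚᵘ-ℕ→ℚ n)) (*≤* (ℤ.*-monoʳ-≤-nonNeg (+ 1) (ℤ.+≤+ m≤n)))))

  ℕ→ℚ-mono-< : ∀ {m n} → m ℕ.< n → ℕ→ℚ m < ℕ→ℚ n
  ℕ→ℚ-mono-< {m} {n} m<n = toℚᵘ-cancel-< (ℚᵘ.<-respˡ-≃ (ℚᵘ.≃-sym (toℚᵘ-ℕ→ℚ m))
    (ℚᵘ.<-respʳ-≃ (ℚᵘ.≃-sym (toℚᵘ-ℕ→ℚ n)) (*<* (ℤ.*-monoʳ-<-pos (+ 1) (ℤ.+<+ m<n)))))

  ℕ→ℚ-cancel-< : ∀ {m n} → ℕ→ℚ m < ℕ→ℚ n → m ℕ.< n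
  ℕ→ℚ-cancel-< {m} {n} p = ℕ.≰⇒> λ n≤m → <⇒≱ p (ℕ→ℚ-mono-≤ {n} {m} n≤m)
    where
    open import Relation.Nullary using (¬_)
    <⇒≱ : ∀ {p q} → p < q → ¬ (q ≤ p)
    <⇒≱ p<q q≤p = <-irrefl refl (<-≤-trans p<q q≤p)

  0≤ℕ→ℚ : ∀ n → 0ℚ ≤ ℕ→ℚ n
  0≤ℕ→ℚ n = ℕ→ℚ-mono-≤ {0} {n} ℕ.z≤n

  unit-fraction : ∀ m .{{_ : ℕ.NonZero m}} → (+ 1 / m) * ℕ→ℚ m ≡ 1ℚ
  unit-fraction m@(suc n) = toℚᵘ-injective (ℚᵘ.≃-trans (toℚᵘ-homo-* (+ 1 / m) (ℕ→ℚ m))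
    (ℚᵘ.≃-trans (ℚᵘ.*-cong (toℚᵘ-fromℚᵘ (mkℚᵘ (+ 1) n)) (toℚᵘ-ℕ→ℚ m))
      (*≡* (trans (ℤ.*-identityʳ (+ 1 ℤ.* + m)) (cong (λ k → + 1 ℤ.* + k) (sym (ℕ.*-identityʳ m)))))))

  0≤unit-fraction : ∀ m .{{_ : ℕ.NonZero m}} → 0ℚ ≤ + 1 / m
  0≤unit-fraction m = nonNegative⁻¹ _ {{normalize-nonNeg 1 m}}

  inv!-suc : ∀ n → ℕ→ℚ (suc n) * inv! (suc n) ≡ inv! n
  inv!-suc n = begin-equality
    N * I              ≡⟨ *-identityʳ (N * I) ⟨
    N * I * 1ℚ         ≡⟨ cong (N * I *_) (unit-fraction (n !) {{n !≢0}}) ⟨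
    N * I * (J * F)    ≡⟨ solve 4 (λ N I J F → N :* I :* (J :* F) := I :* (N :* F) :* J) refl N I J F ⟩
    I * (N * F) * J    ≡⟨ cong (λ p → I * p * J) (ℕ→ℚ-* (suc n) (n !)) ⟨
    I * ℕ→ℚ (suc n !) * J ≡⟨ cong (_* J) (unit-fraction (suc n !) {{suc n !≢0}}) ⟩
    1ℚ * J             ≡⟨ *-identityˡ J ⟩
    J                  ∎
    where
    N = ℕ→ℚ (suc n)
    I = inv! (suc n)
    J = inv! n
    F = ℕ→ℚ (n !)

  0≤inv! : ∀ n → 0ℚ ≤ inv! n
  0≤inv! n = 0≤unit-fraction (n !) {{n !≢0}}

  0≤^ : ∀ {p} n → 0ℚ ≤ p → 0ℚ ≤ p ^ℚ n
  0≤^ zero    0≤p = nonNegative⁻¹ 1ℚ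
  0≤^ (suc n) 0≤p = 0≤* 0≤p (0≤^ n 0≤p)

  0<^ : ∀ {p} n → 0ℚ < p → 0ℚ < p ^ℚ n
  0<^ zero    0<p = positive⁻¹ 1ℚ
  0<^ (suc n) 0<p = 0<* 0<p (0<^ n 0<p)

  ^-mono : ∀ {p q} n → 0ℚ ≤ p → p ≤ q → p ^ℚ n ≤ q ^ℚ n
  ^-mono zero    0≤p p≤q = ≤-refl
  ^-mono (suc n) 0≤p p≤q = *-mono₂ 0≤p (0≤^ n (≤-trans 0≤p p≤q)) p≤q (^-mono n 0≤p p≤q)

  ^-distrib-* : ∀ p q n → (p * q) ^ℚ n ≡ p ^ℚ n * q ^ℚ n
  ^-distrib-* p q zero    = refl
  ^-distrib-* p q (suc n) = trans (cong (p * q *_) (^-distrib-* p q n))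
    (solve 4 (λ p q P Q → p :* q :* (P :* Q) := p :* P :* (q :* Q)) refl p q (p ^ℚ n) (q ^ℚ n))

  1^ : ∀ n → 1ℚ ^ℚ n ≡ 1ℚ
  1^ zero    = refl
  1^ (suc n) = trans (*-identityˡ _) (1^ n)

  ^-swap : ∀ p m n → (p ^ℚ m) ^ℚ n ≡ (p ^ℚ n) ^ℚ m
  ^-swap p zero    n = 1^ n
  ^-swap p (suc m) n = trans (^-distrib-* p (p ^ℚ m) n) (cong (p ^ℚ n *_) (^-swap p m n))

  ^<1 : ∀ {p} n → 0ℚ ≤ p → p < 1ℚ → p ^ℚ suc n < 1ℚ
  ^<1 {p} n 0≤p p<1 = begin-strict
    p * p ^ℚ n ≤⟨ *-mono p 0≤p (subst (p ^ℚ n ≤_) (1^ n) (^-mono n 0≤p (<⇒≤ p<1))) ⟩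
    p * 1ℚ     ≡⟨ *-identityʳ p ⟩
    p          <⟨ p<1 ⟩
    1ℚ         ∎

  bernoulli : ∀ {z} n → 0ℚ ≤ z → z ≤ 1ℚ → 1ℚ - ℕ→ℚ n * z ≤ (1ℚ - z) ^ℚ n
  bernoulli {z} zero    0≤z z≤1 = ≤-reflexive (trans (cong (λ p → 1ℚ - p) (*-zeroˡ z)) refl)
  bernoulli {z} (suc n) 0≤z z≤1 = begin
    1ℚ - ℕ→ℚ (suc n) * z              ≡⟨ cong (λ p → 1ℚ - p * z) (ℕ→ℚ-+ 1 n) ⟩
    1ℚ - (1ℚ + N) * z
      ≡⟨ solve 2 (λ N z → con 1ℚ :- (con 1ℚ :+ N) :* z
          := con 1ℚ :- (con 1ℚ :+ N) :* z :+ con 0ℚ) refl N z ⟩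
    1ℚ - (1ℚ + N) * z + 0ℚ            ≤⟨ +-monoʳ-≤ (1ℚ - (1ℚ + N) * z) (0≤* (0≤ℕ→ℚ n) (0≤* 0≤z 0≤z)) ⟩
    1ℚ - (1ℚ + N) * z + N * (z * z)
      ≡⟨ solve 2 (λ N z → con 1ℚ :- (con 1ℚ :+ N) :* z :+ N :* (z :* z)
          := (con 1ℚ :- z) :* (con 1ℚ :- N :* z)) refl N z ⟩
    (1ℚ - z) * (1ℚ - N * z)           ≤⟨ *-mono (1ℚ - z) (0≤- z≤1) (bernoulli n 0≤z z≤1) ⟩
    (1ℚ - z) * (1ℚ - z) ^ℚ n          ∎
    where N = ℕ→ℚ n

  module _ {a z : ℚ} (0≤a : 0ℚ ≤ a) (0≤z : 0ℚ ≤ z) where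

    private
      b = a + z

      0≤b : 0ℚ ≤ b
      0≤b = 0≤+ 0≤a 0≤z

      a≤b : a ≤ b
      a≤b = subst (_≤ b) (+-identityʳ a) (+-monoʳ-≤ a 0≤z)

    -- Mean value estimate for the power function on the interval from a to b = a + z, with the
    -- derivative bounded by its value at b. The induction splits one factor b as a + z and then
    -- uses a ≤ b.
    power-increment : ∀ n → b ^ℚ suc n ≤ a ^ℚ suc n + ℕ→ℚ (suc n) * z * b ^ℚ n
    power-increment zero    = ≤-reflexive
      (solve 2 (λ a z → (a :+ z) :* con 1ℚ := a :* con 1ℚ :+ con 1ℚ :* z :* con 1ℚ) refl a z)
    power-increment (suc n) = begin
      b * B                       ≡⟨ solve 3 (λ a z B → (a :+ z) :* B := a :* B :+ z :* B) refl a z B ⟩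
      a * B + z * B               ≤⟨ +-monoˡ-≤ (z * B) (*-mono a 0≤a (power-increment n)) ⟩
      a * (A + N * z * C) + z * B
        ≡⟨ solve 6 (λ a z A B C N → a :* (A :+ N :* z :* C) :+ z :* B
            := a :* A :+ z :* B :+ N :* z :* (a :* C)) refl a z A B C N ⟩
      a * A + z * B + N * z * (a * C)
        ≤⟨ +-monoʳ-≤ (a * A + z * B) (*-mono (N * z) (0≤* (0≤ℕ→ℚ (suc n)) 0≤z)
            (*-monoᵣ C (0≤^ n 0≤b) a≤b)) ⟩
      a * A + z * B + N * z * B
        ≡⟨ solve 5 (λ a z A B N → a :* A :+ z :* B :+ N :* z :* B
            := a :* A :+ (con 1ℚ :+ N) :* z :* B) refl a z A B N ⟩
      a * A + (1ℚ + N) * z * B    ≡⟨ cong (λ p → a * A + p * z * B) (ℕ→ℚ-+ 1 (suc n)) ⟨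
      a * A + ℕ→ℚ (suc (suc n)) * z * B ∎
      where
      A = a ^ℚ suc n
      B = b ^ℚ suc n
      C = b ^ℚ n
      N = ℕ→ℚ (suc n)

    term-increment : ∀ n →
      b ^ℚ suc n * inv! (suc n) ≤ a ^ℚ suc n * inv! (suc n) + z * (b ^ℚ n * inv! n)
    term-increment n = begin
      b ^ℚ suc n * I            ≤⟨ *-monoᵣ I (0≤inv! (suc n)) (power-increment n) ⟩
      (A + N * z * C) * I
        ≡⟨ solve 5 (λ A z C N I → (A :+ N :* z :* C) :* I
            := A :* I :+ z :* (C :* (N :* I))) refl A z C N I ⟩
      A * I + z * (C * (N * I)) ≡⟨ cong (λ p → A * I + z * (C * p)) (inv!-suc n) ⟩
      A * I + z * (C * inv! n)  ∎
      where
      A = a ^ℚ suc n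
      C = b ^ℚ n
      N = ℕ→ℚ (suc n)
      I = inv! (suc n)

    -- The derivative of a partial sum is the preceding partial sum.
    expPartial-increment′ : ∀ n → expPartial b (suc n) ≤ expPartial a (suc n) + z * expPartial b n
    expPartial-increment′ zero = begin
      1ℚ + b ^ℚ 1 * inv! 1              ≤⟨ +-monoʳ-≤ 1ℚ (term-increment 0) ⟩
      1ℚ + (a ^ℚ 1 * inv! 1 + z * 1ℚ)   ≡⟨ +-assoc 1ℚ (a ^ℚ 1 * inv! 1) (z * 1ℚ) ⟨
      1ℚ + a ^ℚ 1 * inv! 1 + z * 1ℚ     ∎
    expPartial-increment′ (suc n) = begin
      expPartial b (suc n) + b ^ℚ suc (suc n) * inv! (suc (suc n))
        ≤⟨ +-mono-≤ (expPartial-increment′ n) (term-increment (suc n)) ⟩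
      X + z * Y + (X′ + z * Y′)
        ≡⟨ solve 5 (λ X Y X′ Y′ z → X :+ z :* Y :+ (X′ :+ z :* Y′)
            := X :+ X′ :+ z :* (Y :+ Y′)) refl X Y X′ Y′ z ⟩
      X + X′ + z * (Y + Y′) ∎
      where
      X = expPartial a (suc n)
      Y = expPartial b n
      X′ = a ^ℚ suc (suc n) * inv! (suc (suc n))
      Y′ = b ^ℚ suc n * inv! (suc n)

    -- Replacing the preceding partial sum by the one of the same order adds a nonnegative term. The
    -- estimate becomes (1 - z) S(a + z) ≤ S(a) with a single order n, as the induction on s in
    -- `expPartial≤` requires.
    expPartial-increment : ∀ n → expPartial b n ≤ expPartial a n + z * expPartial b n
    expPartial-increment zero    = subst (_≤ 1ℚ + z * 1ℚ) (+-identityʳ 1ℚ)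
        (+-monoʳ-≤ 1ℚ (0≤* 0≤z (nonNegative⁻¹ 1ℚ)))
    expPartial-increment (suc n) = ≤-trans (expPartial-increment′ n)
      (+-monoʳ-≤ (expPartial a (suc n)) (*-mono z 0≤z
        (subst (_≤ expPartial b (suc n)) (+-identityʳ (expPartial b n))
          (+-monoʳ-≤ (expPartial b n) (0≤* (0≤^ (suc n) 0≤b) (0≤inv! (suc n)))))))

  expPartial-0 : ∀ n → expPartial 0ℚ n ≡ 1ℚ
  expPartial-0 zero    = refl
  expPartial-0 (suc n) = trans (cong₂ _+_ (expPartial-0 n)
    (trans (cong (_* inv! (suc n)) (*-zeroˡ (0ℚ ^ℚ n))) (*-zeroˡ (inv! (suc n))))) (+-identityʳ 1ℚ)

  -- This is exp(sz) (1 - z)^s ≤ 1 on the level of partial sums: each factor 1 - z pays for lowering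
  -- the argument by z, and at argument 0 every partial sum is 1.
  expPartial≤ : ∀ n {z} s → 0ℚ ≤ z → z ≤ 1ℚ → expPartial (ℕ→ℚ s * z) n * (1ℚ - z) ^ℚ s ≤ 1ℚ
  expPartial≤ n {z} zero    0≤z z≤1 = ≤-reflexive (trans (*-identityʳ _)
      (trans (cong (λ p → expPartial p n) (*-zeroˡ z)) (expPartial-0 n)))
  expPartial≤ n {z} (suc s) 0≤z z≤1 = begin
    expPartial (ℕ→ℚ (suc s) * z) n * ((1ℚ - z) * q)
      ≡⟨ cong (λ p → expPartial p n * ((1ℚ - z) * q)) step ⟩
    S * ((1ℚ - z) * q)
      ≡⟨ solve 3 (λ S z q → S :* ((con 1ℚ :- z) :* q) := (S :- z :* S) :* q) refl S z q ⟩
    (S - z * S) * q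
      ≤⟨ *-monoᵣ q (0≤^ s (0≤- z≤1))
          (+-monoˡ-≤ (- (z * S)) (expPartial-increment (0≤* (0≤ℕ→ℚ s) 0≤z) 0≤z n)) ⟩
    (S₀ + z * S - z * S) * q
      ≡⟨ solve 4 (λ S₀ S z q → (S₀ :+ z :* S :- z :* S) :* q := S₀ :* q) refl S₀ S z q ⟩
    S₀ * q                   ≤⟨ expPartial≤ n s 0≤z z≤1 ⟩
    1ℚ                       ∎
    where
    q  = (1ℚ - z) ^ℚ s
    S  = expPartial (ℕ→ℚ s * z + z) n
    S₀ = expPartial (ℕ→ℚ s * z) n
    step : ℕ→ℚ (suc s) * z ≡ ℕ→ℚ s * z + z
    step = trans (cong (_* z) (ℕ→ℚ-+ 1 s))
        (solve 2 (λ S z → (con 1ℚ :+ S) :* z := S :* z :+ z) refl (ℕ→ℚ s) z)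

  module _ {M d t T B r n} (1≤d : 1 ℕ.≤ d) (B≤T : B ℕ.≤ T) (0<T : 0 ℕ.< T) (0<t : 0 ℕ.< t) (0<r : 0ℚ < r)
    (M<E : ℕ→ℚ M < expPartial r n) (small : ℕ→ℚ T * ℕ→ℚ d * r < ℕ→ℚ t * ℕ→ℚ B) where

    private
      instance
        t-pos : Positive (ℕ→ℚ t)
        t-pos = positive (ℕ→ℚ-mono-< {0} {t} 0<t)
        t-nonZero : NonZero (ℕ→ℚ t)
        t-nonZero = pos⇒nonZero (ℕ→ℚ t)

      τ = ℕ→ℚ t
      z q D : ℚ
      z = 1/ τ * r
      q = 1ℚ - z
      D = ℕ→ℚ d

      τz≡r : τ * z ≡ r
      τz≡r = trans (sym (*-assoc τ (1/ τ) r)) (trans (cong (_* r) (*-inverseʳ τ)) (*-identityˡ r))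

      0≤z : 0ℚ ≤ z
      0≤z = <⇒≤ (0<* (positive⁻¹ (1/ τ) {{1/pos⇒pos τ}}) 0<r)

      TDz<B : ℕ→ℚ T * (D * z) < ℕ→ℚ B
      TDz<B = *-cancelˡ-<-nonNeg τ {{pos⇒nonNeg τ}} (subst (_< τ * ℕ→ℚ B) eq small)
        where
        eq : ℕ→ℚ T * D * r ≡ τ * (ℕ→ℚ T * (D * z))
        eq = trans (cong (ℕ→ℚ T * D *_) (sym τz≡r))
          (solve 4 (λ T D τ z → T :* D :* (τ :* z) := τ :* (T :* (D :* z))) refl (ℕ→ℚ T) D τ z)

      0<T′ : 0ℚ < ℕ→ℚ T
      0<T′ = ℕ→ℚ-mono-< {0} {T} 0<T

      -- Here B ≤ T enters. Together with d ≥ 1 it forces z < 1, so that q is positive and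
      -- Bernoulli's inequality applies.
      Dz<1 : D * z < 1ℚ
      Dz<1 = *-cancelˡ-<-nonNeg (ℕ→ℚ T) {{pos⇒nonNeg (ℕ→ℚ T) {{positive 0<T′}}}}
        (subst (ℕ→ℚ T * (D * z) <_) (sym (*-identityʳ (ℕ→ℚ T)))
            (<-≤-trans TDz<B (ℕ→ℚ-mono-≤ {B} {T} B≤T)))

      z<1 : z < 1ℚ
      z<1 = ≤-<-trans (subst (_≤ D * z) (*-identityˡ z) (*-monoᵣ z 0≤z (ℕ→ℚ-mono-≤ {1} {d} 1≤d))) Dz<1

      0<q : 0ℚ < q
      0<q = 0<- z<1

      T-B≤ : ℕ→ℚ (T ℕ.∸ B) ≤ ℕ→ℚ T * q ^ℚ d
      T-B≤ = begin
        ℕ→ℚ (T ℕ.∸ B)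
          ≡⟨ solve 2 (λ x y → x := x :+ y :- y) refl (ℕ→ℚ (T ℕ.∸ B)) (ℕ→ℚ B) ⟩
        ℕ→ℚ (T ℕ.∸ B) + ℕ→ℚ B - ℕ→ℚ B
          ≡⟨ cong (_- ℕ→ℚ B) (trans (sym (ℕ→ℚ-+ (T ℕ.∸ B) B)) (cong ℕ→ℚ (ℕ.m∸n+n≡m B≤T))) ⟩
        ℕ→ℚ T - ℕ→ℚ B
          ≤⟨ +-monoʳ-≤ (ℕ→ℚ T) (neg-antimono-≤ (<⇒≤ TDz<B)) ⟩
        ℕ→ℚ T - ℕ→ℚ T * (D * z)
          ≡⟨ solve 2 (λ x y → x :- x :* y := x :* (con 1ℚ :- y)) refl (ℕ→ℚ T) (D * z) ⟩
        ℕ→ℚ T * (1ℚ - D * z)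
          ≤⟨ *-mono (ℕ→ℚ T) (<⇒≤ 0<T′) (bernoulli d 0≤z (<⇒≤ z<1)) ⟩
        ℕ→ℚ T * q ^ℚ d ∎

      Mq<1 : ℕ→ℚ M * q ^ℚ t < 1ℚ
      Mq<1 = <-≤-trans (*-monoˡ-<-pos (q ^ℚ t) {{positive (0<^ t 0<q)}} M<E)
        (subst (λ p → expPartial p n * q ^ℚ t ≤ 1ℚ) τz≡r (expPartial≤ n t 0≤z (<⇒≤ z<1)))

    -- With z = r / t and q = 1 - z, the assumption on B gives T - B ≤ T (1 - dz) ≤ T q^d, while M
    -- q^t < 1 because M is below a partial sum of exp(tz). Hence the left side is at most T^t (M
    -- q^t)^d < T^t.
    M^d*[T∸B]^t<T^t : M ℕ.^ d ℕ.* (T ℕ.∸ B) ℕ.^ t ℕ.< T ℕ.^ t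
    M^d*[T∸B]^t<T^t = ℕ→ℚ-cancel-< {M ℕ.^ d ℕ.* (T ℕ.∸ B) ℕ.^ t} {T ℕ.^ t} (begin-strict
      ℕ→ℚ (M ℕ.^ d ℕ.* (T ℕ.∸ B) ℕ.^ t)
        ≡⟨ trans (ℕ→ℚ-* (M ℕ.^ d) _) (cong₂ _*_ (ℕ→ℚ-^ M d) (ℕ→ℚ-^ (T ℕ.∸ B) t)) ⟩
      ℕ→ℚ M ^ℚ d * ℕ→ℚ (T ℕ.∸ B) ^ℚ t
        ≤⟨ *-mono (ℕ→ℚ M ^ℚ d) (0≤^ d (0≤ℕ→ℚ M)) (^-mono t (0≤ℕ→ℚ (T ℕ.∸ B)) T-B≤) ⟩
      ℕ→ℚ M ^ℚ d * (ℕ→ℚ T * q ^ℚ d) ^ℚ t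
        ≡⟨ cong (ℕ→ℚ M ^ℚ d *_) (trans (^-distrib-* (ℕ→ℚ T) (q ^ℚ d) t)
            (cong (ℕ→ℚ T ^ℚ t *_) (^-swap q d t))) ⟩
      ℕ→ℚ M ^ℚ d * (ℕ→ℚ T ^ℚ t * (q ^ℚ t) ^ℚ d)
        ≡⟨ solve 3 (λ a b c → a :* (b :* c) := b :* (a :* c))
            refl (ℕ→ℚ M ^ℚ d) (ℕ→ℚ T ^ℚ t) ((q ^ℚ t) ^ℚ d) ⟩
      ℕ→ℚ T ^ℚ t * (ℕ→ℚ M ^ℚ d * (q ^ℚ t) ^ℚ d)
        ≡⟨ cong (ℕ→ℚ T ^ℚ t *_) (^-distrib-* (ℕ→ℚ M) (q ^ℚ t) d) ⟨
      ℕ→ℚ T ^ℚ t * (ℕ→ℚ M * q ^ℚ t) ^ℚ d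
        <⟨ *-monoʳ-<-pos (ℕ→ℚ T ^ℚ t) {{positive (0<^ t 0<T′)}} (pow<1 1≤d) ⟩
      ℕ→ℚ T ^ℚ t * 1ℚ
        ≡⟨ *-identityʳ _ ⟩
      ℕ→ℚ T ^ℚ t
        ≡⟨ ℕ→ℚ-^ T t ⟨
      ℕ→ℚ (T ℕ.^ t) ∎)
      where
      pow<1 : ∀ {d} → 1 ℕ.≤ d → (ℕ→ℚ M * q ^ℚ t) ^ℚ d < 1ℚ
      pow<1 {suc d} _ = ^<1 d (0≤* (0≤ℕ→ℚ M) (0≤^ t (<⇒≤ 0<q))) Mq<1

open import Data.Nat using (ℕ; _≤_; _*_; _∸_)
open import Data.Nat using (zero; suc; _+_; _^_; _<_; z≤n; s≤s)
open import Data.Nat.Base using (_!; _≤′_; ≤′-reflexive; ≤′-step)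
open import Data.Nat.Combinatorics using (_C_; nCn≡1; nCk≡nC[n∸k]; nCk+nC[k+1]≡[n+1]C[k+1])
open import Data.Nat.ListAction using (sum)
open import Data.Nat.Properties
open import Data.Nat.Tactic.RingSolver using (solve-∀)
open import Data.Bool using (Bool; true; false) renaming (_≟_ to _≟B_)
open import Data.Empty using (⊥)
open import Data.Fin using (Fin; zero; suc; inject₁; punchIn; punchOut; splitAt; join)
open import Data.Fin.Properties using (inject₁-injective; punchIn-injective; punchInᵢ≢i;
  punchOut-injective; punchIn-punchOut; any?; all?; ¬∀⟶∃¬; injective⇒≤; join-splitAt)
  renaming (_≟_ to _≟F_; suc-injective to Fin-suc-injective)
import Data.Integer as ℤ
open import Data.List using (List; []; _∷_; _++_; map; foldr; concatMap; cartesianProduct; length;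
  allFin; filter)
open import Data.List.Properties using (length-map; length-++; map-∘; length-tabulate)
open import Data.List.Membership.Propositional using (_∈_; find; lose)
open import Data.List.Membership.Propositional.Properties
  using (∈-∃++; ∈-++⁻; ∈-++⁺ˡ; ∈-++⁺ʳ; ∈-map⁺; ∈-map⁻; ∈-allFin; ∈-filter⁻; ∈-filter⁺;
    ∈-cartesianProduct⁺; ∈-cartesianProduct⁻)
open import Data.List.Relation.Unary.All as All using (All; []; _∷_)
open import Data.List.Relation.Unary.AllPairs using ([]; _∷_)
open import Data.List.Relation.Unary.Any as Any using (Any; here; there)
open import Data.List.Relation.Unary.Unique.Propositional using (Unique)
import Data.List.Relation.Unary.Unique.Propositional.Properties as Unique
open import Data.Product using (_×_; _,_; proj₁; proj₂; ∃; ∃₂)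
open import Data.Rational as ℚ using (_/_)
import Data.Rational.Properties as ℚ
open import Data.Rational.Solver using (module +-*-Solver)
open import Data.Sum as Sum using (_⊎_; inj₁; inj₂; [_,_]′)
open import Data.Sum.Properties using (inj₁-injective; inj₂-injective)
open import Data.Vec as Vec using (Vec; []; _∷_; lookup; tabulate)
open import Data.Vec.Functional using () renaming (_∷_ to _∷ᶠ_)
open import Data.Vec.Properties using (∷-injective; lookup∘tabulate; tabulate∘lookup; tabulate-cong;
  lookup-map)
open import Function using (_∘_; id; case_of_)
open import Function.Definitions using (Injective)
open import Relation.Nullary using (¬_; Dec; contradiction; yes; no)
open import Relation.Nullary.Decidable using (_×-dec_; _→-dec_; ¬?; decidable-stable)
open import Relation.Binary.PropositionalEquality hiding ([_]; J)

private variable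
  A B : Set

Inj : {A B : Set} → (A → B) → Set
Inj f = Injective _≡_ _≡_ f

-- Soundness of the Boolean test for Latin squares.

foldr-all : {A : Set} {g : A → Bool → Bool} {P : A → Set} →
  (∀ x b → g x b ≡ true → P x × b ≡ true) →
  ∀ xs → foldr g true xs ≡ true → ∀ {x} → x ∈ xs → P x
foldr-all g-sound (y ∷ ys) eq (here refl) = proj₁ (g-sound y _ eq)
foldr-all g-sound (y ∷ ys) eq (there x∈ys) = foldr-all g-sound ys (proj₂ (g-sound y _ eq)) x∈ys

allB-sound : {A : Set} (xs : List A) (p : A → Bool) → allB xs p ≡ true →
  ∀ {x} → x ∈ xs → p x ≡ true
allB-sound {A} xs p eq = foldr-all step xs eq
  where
  -- The operator folded by allB is local to Defs; it is recovered from the type of eq.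
  fun : {g : A → Bool → Bool} → foldr g true xs ≡ true → A → Bool → Bool
  fun {g} _ = g

  step : ∀ x b → fun eq x b ≡ true → p x ≡ true × b ≡ true
  step x b with p x
  ... | true  = refl ,_
  ... | false = λ ()

isLatin-sound : ∀ {d} (s : Square d) → isLatin s ≡ true →
  (∀ r → Inj (entry s r)) × (∀ i → Inj (λ r → entry s r i))
isLatin-sound {d} s eq = rows , cols
  where
  -- The type is left to inference because the conjunction inside `isLatin` is local to its
  -- definition. Abstracting over the equality decisions below makes it compute, which rules out the
  -- remaining cases.
  cell : ∀ i j j′ → _
  cell i j j′ = allB-sound (allFin d) _ (allB-sound (allFin d) _
    (allB-sound (allFin d) _ eq (∈-allFin i)) (∈-allFin j)) (∈-allFin j′)

  rows : ∀ r → Inj (entry s r)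
  rows r {j} {j′} e with j ≟F j′ | entry s r j ≟F entry s r j′ | cell r j j′
  ... | yes j≡j′ | _      | _ = j≡j′
  ... | no _     | no ¬e  | _ = contradiction e ¬e

  cols : ∀ i → Inj (λ r → entry s r i)
  cols i {j} {j′} e
    with j ≟F j′ | entry s i j ≟F entry s i j′ | entry s j i ≟F entry s j′ i | cell i j j′
  ... | yes j≡j′ | _     | _     | _ = j≡j′
  ... | no _     | no _  | no ¬e | _ = contradiction e ¬e

-- Monotonicity of the packing property in the number of colours.

restrict : ∀ {G : Graph} {k l} (H : Cover G l) (ι : V G → Fin k → Fin l) →
  (∀ v → Inj (ι v)) → Cover G k
-- The injection may vary with the vertex, since deleting a colouring removes a different colour
-- from each list.
restrict H ι ι-inj = record
  { E         = λ u i v j → E H u (ι u i) v (ι v j)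
  ; symmetric = λ u i v j → symmetric H u (ι u i) v (ι v j)
  ; indep     = λ v i j → indep H v (ι v i) (ι v j)
  ; nonadj    = λ u i v j → nonadj H u (ι u i) v (ι v j)
  ; matching  = λ u i v j j′ adj e e′ →
      ι-inj v (matching H u (ι u i) v (ι v j) (ι v j′) adj e e′)
  }

-- Split off one colouring and pack the remaining k-fold cover.
PackingProperty-suc : ∀ {G} k → 1 ≤ k → PackingProperty G k → PackingProperty G (suc k)
PackingProperty-suc {G} (suc k) _ pack H = c , c-colouring , c-disjoint
  where
  first = pack (restrict H (λ _ → inject₁) (λ _ → inject₁-injective))

  c₀ : V G → Fin (suc (suc k))
  c₀ v = inject₁ (proj₁ first zero v)

  rest = pack (restrict H (punchIn ∘ c₀) (λ v → punchIn-injective (c₀ v) _ _))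

  c : Fin (suc (suc k)) → V G → Fin (suc (suc k))
  c zero    v = c₀ v
  c (suc a) v = punchIn (c₀ v) (proj₁ rest a v)

  c-colouring : ∀ a → IsColouring H (c a)
  c-colouring zero    = proj₁ (proj₂ first) zero
  c-colouring (suc a) = proj₁ (proj₂ rest) a

  c-disjoint : ∀ a b → ¬ a ≡ b → ∀ v → ¬ c a v ≡ c b v
  c-disjoint zero    zero    a≢b v _  = a≢b refl
  c-disjoint zero    (suc b) a≢b v eq = punchInᵢ≢i (c₀ v) _ (sym eq)
  c-disjoint (suc a) zero    a≢b v eq = punchInᵢ≢i (c₀ v) _ eq
  c-disjoint (suc a) (suc b) a≢b v eq =
    proj₂ (proj₂ rest) a b (a≢b ∘ cong suc) v (punchIn-injective (c₀ v) _ _ eq)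

PackingProperty-mono : ∀ {G} {k l} → 1 ≤ k → k ≤ l → PackingProperty G k → PackingProperty G l
PackingProperty-mono {G} {k} 1≤k k≤l pack = go (≤⇒≤′ k≤l)
  where
  go : ∀ {l} → k ≤′ l → PackingProperty G l
  go (≤′-reflexive refl) = pack
  go (≤′-step k≤′l)      = PackingProperty-suc _ (≤-trans 1≤k (≤′⇒≤ k≤′l)) (go k≤′l)

-- Finite sums over lists.

∑ : List A → (A → ℕ) → ℕ
∑ xs f = sum (map f xs)

syntax ∑ xs (λ x → e) = ∑[ x ∈ xs ] e

∑-++ : ∀ (f : A → ℕ) xs ys → ∑ (xs ++ ys) f ≡ ∑ xs f + ∑ ys f
∑-++ f []       ys = refl
∑-++ f (x ∷ xs) ys = trans (cong (f x +_) (∑-++ f xs ys)) (sym (+-assoc (f x) _ _))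

∑-mono : ∀ {f g : A → ℕ} xs → (∀ {x} → x ∈ xs → f x ≤ g x) → ∑ xs f ≤ ∑ xs g
∑-mono []       f≤g = z≤n
∑-mono (x ∷ xs) f≤g = +-mono-≤ (f≤g (here refl)) (∑-mono xs (f≤g ∘ there))

∑-cong : ∀ {f g : A → ℕ} xs → (∀ {x} → x ∈ xs → f x ≡ g x) → ∑ xs f ≡ ∑ xs g
∑-cong []       f≡g = refl
∑-cong (x ∷ xs) f≡g = cong₂ _+_ (f≡g (here refl)) (∑-cong xs (f≡g ∘ there))

∑-const : ∀ (xs : List A) c → ∑ xs (λ _ → c) ≡ length xs * c
∑-const []       c = refl
∑-const (x ∷ xs) c = cong (c +_) (∑-const xs c)

∑-+ : ∀ (f g : A → ℕ) xs → ∑[ x ∈ xs ] (f x + g x) ≡ ∑ xs f + ∑ xs g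
∑-+ f g []       = refl
∑-+ f g (x ∷ xs) = trans (cong (f x + g x +_) (∑-+ f g xs)) (lemma (f x) (g x) _ _)
  where
  lemma : ∀ a b c d → a + b + (c + d) ≡ a + c + (b + d)
  lemma = solve-∀

∑-*ˡ : ∀ c (f : A → ℕ) xs → ∑[ x ∈ xs ] (c * f x) ≡ c * ∑ xs f
∑-*ˡ c f []       = sym (*-zeroʳ c)
∑-*ˡ c f (x ∷ xs) = trans (cong (c * f x +_) (∑-*ˡ c f xs)) (sym (*-distribˡ-+ c (f x) _))

∑-swap : ∀ (f : A → B → ℕ) xs ys →
  ∑[ x ∈ xs ] ∑[ y ∈ ys ] f x y ≡ ∑[ y ∈ ys ] ∑[ x ∈ xs ] f x y
∑-swap f []       ys = sym (trans (∑-const ys 0) (*-zeroʳ (length ys)))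
∑-swap f (x ∷ xs) ys = trans (cong (∑ ys (f x) +_) (∑-swap f xs ys)) (sym (∑-+ (f x) _ ys))

∑-map : ∀ (f : B → ℕ) (h : A → B) xs → ∑ (map h xs) f ≡ ∑ xs (f ∘ h)
∑-map f h xs = cong sum (sym (map-∘ xs))

∑-cartesianProduct : ∀ (f : A × B → ℕ) xs ys →
  ∑ (cartesianProduct xs ys) f ≡ ∑[ x ∈ xs ] ∑[ y ∈ ys ] f (x , y)
∑-cartesianProduct f []       ys = refl
∑-cartesianProduct f (x ∷ xs) ys = trans (∑-++ f (map (x ,_) ys) _)
  (cong₂ _+_ (∑-map f (x ,_) ys) (∑-cartesianProduct f xs ys))

∑-positive : ∀ {f : A → ℕ} xs → 0 < ∑ xs f → ∃ λ x → x ∈ xs × 0 < f x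
∑-positive {f = f} (x ∷ xs) pos with f x in eq
... | suc _ = x , here refl , subst (0 <_) (sym eq) (s≤s z≤n)
... | zero  = case ∑-positive xs pos of λ { (y , y∈xs , p) → y , there y∈xs , p }

-- Most of the counting below is an instance of this comparison. Each positive term uses up one
-- partner in ys; injectivity of R and uniqueness of xs keep the partners of later terms among the
-- remaining entries.
∑-inject : ∀ {f : A → ℕ} {g : B → ℕ} (R : A → B → Set) xs ys → Unique xs →
  (∀ {x} → x ∈ xs → 0 < f x → ∃ λ y → y ∈ ys × R x y × f x ≤ g y) →
  (∀ {x x′ y} → x ∈ xs → x′ ∈ xs → R x y → R x′ y → x ≡ x′) →
  ∑ xs f ≤ ∑ ys g
∑-inject R [] ys _ match inj = z≤n
∑-inject {f = f} {g} R (x ∷ xs) ys (x∉xs ∷ uniq) match inj with f x in eq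
... | zero  = ∑-inject R xs ys uniq (match ∘ there) (λ p q → inj (there p) (there q))
... | suc m with match (here refl) (subst (0 <_) (sym eq) (s≤s z≤n))
... | y , y∈ys , Rxy , fx≤gy with ∈-∃++ y∈ys
... | as , bs , refl = begin
  suc m + ∑ xs f                ≤⟨ +-mono-≤ (subst (_≤ g y) eq fx≤gy)
                                     (∑-inject R xs (as ++ bs) uniq match′
                                         (λ p q → inj (there p) (there q))) ⟩
  g y + ∑ (as ++ bs) g          ≡⟨ cong (g y +_) (∑-++ g as bs) ⟩
  g y + (∑ as g + ∑ bs g)       ≡⟨ lemma (g y) (∑ as g) _ ⟩
  ∑ as g + (g y + ∑ bs g)       ≡⟨ ∑-++ g as (y ∷ bs) ⟨
  ∑ (as ++ y ∷ bs) g            ∎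
  where
  open ≤-Reasoning
  lemma : ∀ a b c → a + (b + c) ≡ b + (a + c)
  lemma = solve-∀
  match′ : ∀ {x′} → x′ ∈ xs → 0 < f x′ → ∃ λ y′ → y′ ∈ as ++ bs × R x′ y′ × f x′ ≤ g y′
  match′ {x′} x′∈xs pos with match (there x′∈xs) pos
  ... | y′ , y′∈ , Rxy′ , le with ∈-++⁻ as y′∈
  ... | inj₁ y′∈as           = y′ , ∈-++⁺ˡ y′∈as , Rxy′ , le
  ... | inj₂ (there y′∈bs)   = y′ , ∈-++⁺ʳ as y′∈bs , Rxy′ , le
  ... | inj₂ (here refl)     =
    contradiction (inj (here refl) (there x′∈xs) Rxy Rxy′) (All.lookup x∉xs x′∈xs)

𝟙 : {P : Set} → Dec P → ℕ
𝟙 (yes _) = 1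
𝟙 (no _)  = 0

𝟙-yes : {P : Set} (P? : Dec P) → P → 𝟙 P? ≡ 1
𝟙-yes (yes _) p = refl
𝟙-yes (no ¬p) p = contradiction p ¬p

𝟙-positive : {P : Set} (P? : Dec P) → 0 < 𝟙 P? → P
𝟙-positive (yes p) _ = p

𝟙≤1 : {P : Set} (P? : Dec P) → 𝟙 P? ≤ 1
𝟙≤1 (yes _) = ≤-refl
𝟙≤1 (no _)  = z≤n

-- Enumeration of tuples and permutations.

length-cartesianProduct : ∀ (xs : List A) (ys : List B) →
  length (cartesianProduct xs ys) ≡ length xs * length ys
length-cartesianProduct []       ys = refl
length-cartesianProduct (x ∷ xs) ys = trans (length-++ (map (x ,_) ys))
  (cong₂ _+_ (length-map (x ,_) ys) (length-cartesianProduct xs ys))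

length-concatMap : ∀ (h : A → List B) m xs → (∀ x → length (h x) ≡ m) →
  length (concatMap h xs) ≡ length xs * m
length-concatMap h m []       eq = refl
length-concatMap h m (x ∷ xs) eq =
  trans (length-++ (h x)) (cong₂ _+_ (eq x) (length-concatMap h m xs eq))

concatMap-unique : ∀ (h : A → List B) xs → Unique xs → (∀ x → Unique (h x)) →
  (∀ {x x′ y} → y ∈ h x → y ∈ h x′ → x ≡ x′) → Unique (concatMap h xs)
concatMap-unique h []       _             _  _    = []
concatMap-unique h (x ∷ xs) (x∉xs ∷ uniq) hu disj =
  Unique.++⁺ (hu x) (concatMap-unique h xs uniq hu disj)
    λ { (y∈hx , y∈rest) → go x∉xs y∈hx y∈rest }
  where
  go : ∀ {y zs} → All (x ≢_) zs → y ∈ h x → ¬ y ∈ concatMap h zs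
  go {zs = z ∷ zs} (x≢z ∷ all) y∈hx y∈ with ∈-++⁻ (h z) y∈
  ... | inj₁ y∈hz = x≢z (disj y∈hx y∈hz)
  ... | inj₂ y∈zs = go all y∈hx y∈zs

∈-concatMap : ∀ (h : A → List B) {xs x y} → x ∈ xs → y ∈ h x → y ∈ concatMap h xs
∈-concatMap h {x ∷ xs} (here refl) y∈ = ∈-++⁺ˡ y∈
∈-concatMap h {x ∷ xs} (there x∈)  y∈ = ∈-++⁺ʳ (h x) (∈-concatMap h x∈ y∈)

∈-concatMap⁻′ : ∀ (h : A → List B) xs {y} → y ∈ concatMap h xs → ∃ λ x → x ∈ xs × y ∈ h x
∈-concatMap⁻′ h (x ∷ xs) y∈ with ∈-++⁻ (h x) y∈
... | inj₁ y∈hx = x , here refl , y∈hx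
... | inj₂ y∈xs = case ∈-concatMap⁻′ h xs y∈xs of λ { (x′ , x′∈ , y∈) → x′ , there x′∈ , y∈ }

length-allVecs : ∀ (xs : List A) n → length (allVecs xs n) ≡ length xs ^ n
length-allVecs xs zero    = refl
length-allVecs xs (suc n) = length-concatMap _ _ xs λ x →
  trans (length-map (x ∷_) (allVecs xs n)) (length-allVecs xs n)

allVecs-unique : ∀ {xs : List A} n → Unique xs → Unique (allVecs xs n)
allVecs-unique zero    uniq = [] ∷ []
allVecs-unique {xs = xs} (suc n) uniq = concatMap-unique _ xs uniq
  (λ x → Unique.map⁺ (proj₂ ∘ ∷-injective) (allVecs-unique n uniq))
  λ p q → case ∈-map⁻ _ p of λ { (_ , _ , refl) → case ∈-map⁻ _ q of λ { (_ , _ , refl) → refl } }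

∈-allVecs : ∀ {xs : List A} {n} (v : Vec A n) → (∀ i → lookup v i ∈ xs) → v ∈ allVecs xs n
∈-allVecs []      _  = here refl
∈-allVecs (x ∷ v) v∈ = ∈-concatMap _ (v∈ zero) (∈-map⁺ (x ∷_) (∈-allVecs v (v∈ ∘ suc)))

∈-allVecs⁻ : ∀ (xs : List A) {n} {v : Vec A n} → v ∈ allVecs xs n → ∀ i → lookup v i ∈ xs
∈-allVecs⁻ xs {suc n} v∈ i with ∈-concatMap⁻′ _ xs v∈
... | x , x∈ , v∈′ with ∈-map⁻ _ v∈′
... | w , w∈ , refl with i
... | zero  = x∈
... | suc j = ∈-allVecs⁻ xs w∈ j

Vec-ext : ∀ {n} {v w : Vec A n} → (∀ i → lookup v i ≡ lookup w i) → v ≡ w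
Vec-ext {v = v} {w} eq =
  trans (sym (tabulate∘lookup v)) (trans (tabulate-cong eq) (tabulate∘lookup w))

insert : ∀ {n} → Fin (suc n) → Vec (Fin n) n → Vec (Fin (suc n)) (suc n)
insert x p = x ∷ Vec.map (punchIn x) p

-- A permutation is encoded by its first entry x and a smaller permutation whose values are shifted
-- past x, so that the count n! follows the recursion.
perms : ∀ n → List (Vec (Fin n) n)
perms zero    = [] ∷ []
perms (suc n) = concatMap (λ x → map (insert x) (perms n)) (allFin (suc n))

length-perms : ∀ n → length (perms n) ≡ n !
length-perms zero    = refl
length-perms (suc n) = trans
  (length-concatMap (λ x → map (insert x) (perms n)) (n !) (allFin (suc n))
      λ x → trans (length-map _ (perms n)) (length-perms n))
  (cong (_* n !) (length-tabulate {n = suc n} id))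

insert-injective : ∀ {n} (x : Fin (suc n)) →
  Inj (insert x)
insert-injective x {p} {q} eq = Vec-ext λ i → punchIn-injective x _ _
  (trans (sym (lookup-map i (punchIn x) p))
    (trans (cong (λ v → lookup v (suc i)) eq) (lookup-map i (punchIn x) q)))

perms-unique : ∀ n → Unique (perms n)
perms-unique zero    = [] ∷ []
perms-unique (suc n) = concatMap-unique _ (allFin (suc n)) (Unique.allFin⁺ (suc n))
  (λ x → Unique.map⁺ (insert-injective x) (perms-unique n))
  λ p q → trans (sym (cong Vec.head (proj₂ (proj₂ (∈-map⁻ _ p)))))
      (cong Vec.head (proj₂ (proj₂ (∈-map⁻ _ q))))

perms-injective : ∀ {n} {p : Vec (Fin n) n} → p ∈ perms n → Inj (lookup p)
perms-injective {suc n} p∈ {i} {j} eq with ∈-concatMap⁻′ _ (allFin (suc n)) p∈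
... | x , _ , p∈′ with ∈-map⁻ _ p∈′
... | q , q∈ , refl with i | j
... | zero  | zero  = refl
... | zero  | suc j = contradiction (sym (trans eq (lookup-map j _ q))) (punchInᵢ≢i x _)
... | suc i | zero  = contradiction (trans (sym (lookup-map i _ q)) eq) (punchInᵢ≢i x _)
... | suc i | suc j = cong suc (perms-injective q∈ (punchIn-injective x _ _
  (trans (sym (lookup-map i _ q)) (trans eq (lookup-map j _ q)))))

∈-perms : ∀ {n} (p : Vec (Fin n) n) → Inj (lookup p) → p ∈ perms n
∈-perms {zero}  []      _   = here refl
∈-perms {suc n} (x ∷ p) inj =
  ∈-concatMap _ (∈-allFin x) (subst (_∈ map (insert x) (perms n)) (cong (x ∷_) q-spec)
    (∈-map⁺ (insert x) (∈-perms q q-inj)))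
  where
  x≢ : ∀ i → x ≢ lookup p i
  x≢ i eq = case inj {zero} {suc i} eq of λ ()
  q = tabulate λ i → punchOut (x≢ i)
  q-inj : Inj (lookup q)
  q-inj {i} {j} eq = Fin-suc-injective (inj {suc i} {suc j}
    (punchOut-injective (x≢ i) (x≢ j)
      (trans (sym (lookup∘tabulate _ i)) (trans eq (lookup∘tabulate _ j)))))
  q-spec : Vec.map (punchIn x) q ≡ p
  q-spec = Vec-ext λ i → trans (lookup-map i (punchIn x) q)
    (trans (cong (punchIn x) (lookup∘tabulate _ i)) (punchIn-punchOut (x≢ i)))

-- Pigeonhole principles.

narrow : ∀ {m n} (y : Fin (suc n)) (f : Fin m → Fin (suc n)) → (∀ x → f x ≢ y) → Fin m → Fin n
narrow y f y∉ x = punchOut (λ y≡fx → y∉ x (sym y≡fx))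

narrow-injective : ∀ {m n} (y : Fin (suc n)) (f : Fin m → Fin (suc n)) (y∉ : ∀ x → f x ≢ y) →
  Inj f → Inj (narrow y f y∉)
narrow-injective y f y∉ inj {x} {x′} eq =
  inj (punchOut-injective (λ e → y∉ x (sym e)) (λ e → y∉ x′ (sym e)) eq)

abstract

  -- Otherwise a choice of preimages would inject `Fin n` into `Fin m`.
  miss : ∀ {m n} → m < n → (f : Fin m → Fin n) → ∃ λ y → ∀ x → f x ≢ y
  miss {m} {n} m<n f with all? (λ y → any? (λ x → f x ≟F y))
  ... | yes onto = contradiction (injective⇒≤ section-inj) (<⇒≱ m<n)
    where
    section-inj : Inj (λ y → proj₁ (onto y))
    section-inj {y} {y′} eq = trans (sym (proj₂ (onto y))) (trans (cong f eq) (proj₂ (onto y′)))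
  ... | no ¬onto = case ¬∀⟶∃¬ n _ (λ y → any? (λ x → f x ≟F y)) ¬onto of λ
    { (y , ¬hit) → y , λ x fx≡y → ¬hit (x , fx≡y) }

  -- A missed value could be removed from the codomain, leaving an injection into a smaller set.
  injective⇒surjective : ∀ {n} {f : Fin n → Fin n} → Inj f → ∀ y → ∃ λ x → f x ≡ y
  injective⇒surjective {suc n} {f} inj y with any? (λ x → f x ≟F y)
  ... | yes hit = hit
  ... | no ¬hit = contradiction
    (injective⇒≤ (narrow-injective y f (λ x eq → ¬hit (x , eq)) inj)) 1+n≰n

  -- With disjoint images, f and g would combine to an injection of `Fin (a + b)` into `Fin n`.
  collision : ∀ {a b n} {f : Fin a → Fin n} {g : Fin b → Fin n} → n < a + b → Inj f → Inj g →
    ∃₂ λ x y → f x ≡ g y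
  collision {a} {b} {n} {f} {g} n<a+b f-inj g-inj with any? (λ x → any? (λ y → f x ≟F g y))
  ... | yes (x , y , eq) = x , y , eq
  ... | no disjoint = contradiction (injective⇒≤ {f = h ∘ splitAt a} h-inj) (<⇒≱ n<a+b)
    where
    h : Fin a ⊎ Fin b → Fin n
    h = [ f , g ]′
    h-inj′ : ∀ s t → h s ≡ h t → s ≡ t
    h-inj′ (inj₁ x) (inj₁ x′) eq = cong inj₁ (f-inj eq)
    h-inj′ (inj₁ x) (inj₂ y)  eq = contradiction (x , y , eq) disjoint
    h-inj′ (inj₂ y) (inj₁ x)  eq = contradiction (x , y , sym eq) disjoint
    h-inj′ (inj₂ y) (inj₂ y′) eq = cong inj₂ (g-inj eq)
    h-inj : Inj (h ∘ splitAt a)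
    h-inj {i} {j} eq = trans (sym (join-splitAt a b i))
      (trans (cong (join a b) (h-inj′ (splitAt a i) (splitAt a j) eq)) (join-splitAt a b j))

  -- After removal of one missed value the map is an injective endomap of `Fin n`, hence onto. The
  -- missed value later serves as the exceptional row of a column.
  injective-image : ∀ {n} {f : Fin n → Fin (suc n)} → Inj f →
    ∃ λ y → (∀ x → f x ≢ y) × (∀ y′ → y′ ≢ y → ∃ λ x → f x ≡ y′)
  injective-image {n} {f} inj with miss ≤-refl f
  ... | y , y∉ = y , y∉ , hit
    where
    hit : ∀ y′ → y′ ≢ y → ∃ λ x → f x ≡ y′
    hit y′ y′≢y =
      case injective⇒surjective (narrow-injective y f y∉ inj) (punchOut (y′≢y ∘ sym)) of λ
        { (x , eq) → x , punchOut-injective (λ e → y∉ x (sym e)) (y′≢y ∘ sym) eq }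

-- Subsets of prescribed size.

-- Split n a b encodes an a-element subset of Fin n with b-element complement.
data Split : ℕ → ℕ → ℕ → Set where
  []  : Split 0 0 0
  inn : ∀ {n a b} → Split n a b → Split (suc n) (suc a) b
  out : ∀ {n a b} → Split n a b → Split (suc n) a (suc b)

enum : ∀ {n a b} → Split n a b → Fin a ⊎ Fin b → Fin n
enum (inn S) (inj₁ zero)    = zero
enum (inn S) (inj₁ (suc i)) = suc (enum S (inj₁ i))
enum (inn S) (inj₂ j)       = suc (enum S (inj₂ j))
enum (out S) (inj₁ i)       = suc (enum S (inj₁ i))
enum (out S) (inj₂ zero)    = zero
enum (out S) (inj₂ (suc j)) = suc (enum S (inj₂ j))

index : ∀ {n a b} → Split n a b → Fin n → Fin a ⊎ Fin b
index (inn S) zero    = inj₁ zero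
index (inn S) (suc x) = Sum.map₁ suc (index S x)
index (out S) zero    = inj₂ zero
index (out S) (suc x) = Sum.map₂ suc (index S x)

index-enum : ∀ {n a b} (S : Split n a b) i → index S (enum S i) ≡ i
index-enum (inn S) (inj₁ zero)    = refl
index-enum (inn S) (inj₁ (suc i)) = cong (Sum.map₁ suc) (index-enum S (inj₁ i))
index-enum (inn S) (inj₂ j)       = cong (Sum.map₁ suc) (index-enum S (inj₂ j))
index-enum (out S) (inj₁ i)       = cong (Sum.map₂ suc) (index-enum S (inj₁ i))
index-enum (out S) (inj₂ zero)    = refl
index-enum (out S) (inj₂ (suc j)) = cong (Sum.map₂ suc) (index-enum S (inj₂ j))

enum-index : ∀ {n a b} (S : Split n a b) x → enum S (index S x) ≡ x
enum-index (inn S) zero = refl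
enum-index (inn S) (suc x) with index S x | enum-index S x
... | inj₁ i | eq = cong suc eq
... | inj₂ j | eq = cong suc eq
enum-index (out S) zero = refl
enum-index (out S) (suc x) with index S x | enum-index S x
... | inj₁ i | eq = cong suc eq
... | inj₂ j | eq = cong suc eq

enum-injective : ∀ {n a b} (S : Split n a b) → Inj (enum S)
enum-injective S {i} {j} eq =
  trans (sym (index-enum S i)) (trans (cong (index S) eq) (index-enum S j))

index-injective : ∀ {n a b} (S : Split n a b) → Inj (index S)
index-injective S {x} {y} eq =
  trans (sym (enum-index S x)) (trans (cong (enum S) eq) (enum-index S y))

_⟨_⟩ : ∀ {n a b} → Split n a b → Fin a → Fin n
S ⟨ i ⟩ = enum S (inj₁ i)

_⟨_⟩ᶜ : ∀ {n a b} → Split n a b → Fin b → Fin n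
S ⟨ j ⟩ᶜ = enum S (inj₂ j)

inside-injective : ∀ {n a b} (S : Split n a b) → Inj (S ⟨_⟩)
inside-injective S = inj₁-injective ∘ enum-injective S

_∈ₛ_ : ∀ {n a b} → Fin n → Split n a b → Set
x ∈ₛ S = ∃ λ i → S ⟨ i ⟩ ≡ x

abstract
  _∈ₛ?_ : ∀ {n a b} (x : Fin n) (S : Split n a b) → Dec (x ∈ₛ S)
  x ∈ₛ? S = any? (λ i → (S ⟨ i ⟩) ≟F x)

∉⇒complement : ∀ {n a b} (S : Split n a b) x → ¬ (x ∈ₛ S) → ∃ λ j → S ⟨ j ⟩ᶜ ≡ x
∉⇒complement S x x∉ with index S x | enum-index S x
... | inj₁ i | eq = contradiction (i , eq) x∉
... | inj₂ j | eq = j , eq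

-- Both sets have size a, so inclusion forces equality. In the case `out`, `inn` the a elements on
-- the left avoid 0 and would embed into the a - 1 nonzero elements on the right.
Split-ext : ∀ {n a b} (S S′ : Split n a b) → (∀ i → (S ⟨ i ⟩) ∈ₛ S′) → S ≡ S′
Split-ext []      []       _ = refl
Split-ext (inn S) (inn S′) ⊆ = cong inn (Split-ext S S′ λ i → case ⊆ (suc i) of λ
  { (suc j , eq) → j , Fin-suc-injective eq })
Split-ext (inn S) (out S′) ⊆ = case ⊆ zero of λ ()
Split-ext (out S) (inn S′) ⊆ = contradiction (injective⇒≤ embed-injective) 1+n≰n
  where
  embed : ∀ i → (S ⟨ i ⟩) ∈ₛ S′
  embed i = case ⊆ i of λ { (suc j , eq) → j , Fin-suc-injective eq }
  embed-injective : Inj (proj₁ ∘ embed)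
  embed-injective {i} {j} eq = inside-injective S
    (trans (sym (proj₂ (embed i))) (trans (cong (S′ ⟨_⟩) eq) (proj₂ (embed j))))
Split-ext (out S) (out S′) ⊆ = cong out (Split-ext S S′ λ i → case ⊆ i of λ
  { (j , eq) → j , Fin-suc-injective eq })

splits : ∀ n a b → List (Split n a b)
splits zero    zero    zero    = [] ∷ []
splits zero    zero    (suc b) = []
splits zero    (suc a) b       = []
splits (suc n) zero    zero    = []
splits (suc n) (suc a) zero    = map inn (splits n a zero)
splits (suc n) zero    (suc b) = map out (splits n zero b)
splits (suc n) (suc a) (suc b) = map inn (splits n a (suc b)) ++ map out (splits n (suc a) b)

inn-injective : ∀ {n a b} → Inj (inn {n} {a} {b})
inn-injective refl = refl

out-injective : ∀ {n a b} → Inj (out {n} {a} {b})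
out-injective refl = refl

splits-unique : ∀ n a b → Unique (splits n a b)
splits-unique zero    zero    zero    = [] ∷ []
splits-unique zero    zero    (suc b) = []
splits-unique zero    (suc a) b       = []
splits-unique (suc n) zero    zero    = []
splits-unique (suc n) (suc a) zero    = Unique.map⁺ inn-injective (splits-unique n a zero)
splits-unique (suc n) zero    (suc b) = Unique.map⁺ out-injective (splits-unique n zero b)
splits-unique (suc n) (suc a) (suc b) = Unique.++⁺
  (Unique.map⁺ inn-injective (splits-unique n a (suc b)))
  (Unique.map⁺ out-injective (splits-unique n (suc a) b))
  λ { (p , q) → case ∈-map⁻ inn p of λ { (_ , _ , refl) → case ∈-map⁻ out q of λ { (_ , _ , ()) } } }

nC0≡1 : ∀ n → n C 0 ≡ 1
nC0≡1 n = trans (nCk≡nC[n∸k] {0} {n} z≤n) (nCn≡1 n)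

length-splits : ∀ n a b → n ≡ a + b → length (splits n a b) ≡ n C a
length-splits zero    zero    zero    _  = refl
length-splits (suc n) (suc a) zero    eq = trans (length-map inn (splits n a zero))
  (trans (length-splits n a zero (suc-injective eq))
    (subst (λ m → n C a ≡ suc n C suc m) n≡a
        (trans (cong (n C_) (sym n≡a)) (trans (nCn≡1 n) (sym (nCn≡1 (suc n)))))))
  where
  n≡a : n ≡ a
  n≡a = trans (suc-injective eq) (+-identityʳ a)
length-splits (suc n) zero    (suc b) eq = trans (length-map out (splits n zero b))
  (trans (length-splits n zero b (suc-injective eq)) (trans (nC0≡1 n) (sym (nC0≡1 (suc n)))))
length-splits (suc n) (suc a) (suc b) eq = begin
  length (map inn (splits n a (suc b)) ++ map out (splits n (suc a) b))
    ≡⟨ length-++ (map inn (splits n a (suc b))) ⟩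
  length (map inn (splits n a (suc b))) + length (map out (splits n (suc a) b))
    ≡⟨ cong₂ _+_ (length-map inn (splits n a (suc b))) (length-map out (splits n (suc a) b)) ⟩
  length (splits n a (suc b)) + length (splits n (suc a) b)
    ≡⟨ cong₂ _+_ (length-splits n a (suc b) (suc-injective eq))
                 (length-splits n (suc a) b (trans (suc-injective eq) (+-suc a b))) ⟩
  n C a + n C suc a
    ≡⟨ nCk+nC[k+1]≡[n+1]C[k+1] n a ⟩
  suc n C suc a
    ∎
  where open ≡-Reasoning

-- Averaging and the union bound.

argmin : ∀ {A : Set} (h : A → ℕ) xs → 0 < length xs → ∃ λ x → x ∈ xs × (∀ {y} → y ∈ xs → h x ≤ h y)
argmin h (x ∷ []) _ = x , here refl , λ { (here refl) → ≤-refl }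
argmin h (x ∷ y ∷ ys) _ with argmin h (y ∷ ys) (s≤s z≤n)
... | z , z∈ , min with ≤-total (h x) (h z)
... | inj₁ hx≤hz = x , here refl , λ { (here refl) → ≤-refl ; (there w∈) → ≤-trans hx≤hz (min w∈) }
... | inj₂ hz≤hx = z , there z∈ , λ { (here refl) → hz≤hx ; (there w∈) → min w∈ }

below-average : ∀ {A : Set} (h : A → ℕ) xs → 0 < length xs → ∃ λ x → x ∈ xs × length xs * h x ≤ ∑ xs h
below-average h xs pos = case argmin h xs pos of λ
  { (x , x∈ , min) → x , x∈ , subst (_≤ ∑ xs h) (∑-const xs (h x)) (∑-mono xs min) }

length-filter : ∀ {A : Set} {P : A → Set} (P? : ∀ x → Dec (P x)) xs →
  length (filter P? xs) ≡ ∑ xs (𝟙 ∘ P?)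
length-filter P? [] = refl
length-filter P? (x ∷ xs) with P? x
... | yes _ = cong suc (length-filter P? xs)
... | no _  = length-filter P? xs

module _ {A : Set} (xs : List A) (nonempty : 0 < length xs)
  {S : A → A → Set} (S? : ∀ x y → Dec (S x y))
  (G : ℕ) (count : ∀ {y} → y ∈ xs → ∑[ x ∈ xs ] 𝟙 (S? x y) ≤ G) where

  -- `S x y` is read as: the candidate y survives the choice x. Thus `count` says that each
  -- candidate survives a random choice with probability at most G / length xs.
  Eliminated : ℕ → List A → Set
  Eliminated t ys =
    ∃ λ (x : Fin t → A) → (∀ b → x b ∈ xs) × (∀ y → y ∈ ys → ¬ (∀ b → S (x b) y))

  -- The union bound over t independent uniform choices from xs, made greedily: each choice keeps
  -- at most the average number of survivors.
  no-survivors : ∀ t ys → (∀ {y} → y ∈ ys → y ∈ xs) → length ys * G ^ t < length xs ^ t →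
    Eliminated t ys
  no-survivors zero [] _ _ = (λ ()) , (λ ()) , λ _ ()
  no-survivors zero (_ ∷ _) _ (s≤s ())
  no-survivors (suc t) ys ys⊆xs few =
    case below-average (λ x → ∑[ y ∈ ys ] 𝟙 (S? x y)) xs nonempty of λ
      { (x , x∈ , le) → extend x x∈ le }
    where
    open ≤-Reasoning
    extend : ∀ x → x ∈ xs →
      length xs * ∑[ y ∈ ys ] 𝟙 (S? x y) ≤ ∑[ x ∈ xs ] ∑[ y ∈ ys ] 𝟙 (S? x y) → Eliminated (suc t) ys
    extend x x∈ le =
      case no-survivors t survivors (ys⊆xs ∘ proj₁ ∘ ∈-filter⁻ (S? x)) fewer of λ
        { (x′ , x′∈ , none) →
          (x ∷ᶠ x′) ,
          (λ { zero → x∈ ; (suc b) → x′∈ b }) ,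
          λ y y∈ all → none y (∈-filter⁺ (S? x) y∈ (all zero)) (all ∘ suc) }
      where
      survivors = filter (S? x) ys
      T = length xs
      fewer : length survivors * G ^ t < T ^ t
      fewer = *-cancelˡ-< T _ _ (begin-strict
        T * (length survivors * G ^ t)    ≡⟨ cong (λ n → T * (n * G ^ t)) (length-filter (S? x) ys) ⟩
        T * (∑[ y ∈ ys ] 𝟙 (S? x y) * G ^ t) ≡⟨ *-assoc T _ (G ^ t) ⟨
        T * ∑[ y ∈ ys ] 𝟙 (S? x y) * G ^ t ≤⟨ *-monoˡ-≤ (G ^ t) le ⟩
        ∑[ x ∈ xs ] ∑[ y ∈ ys ] 𝟙 (S? x y) * G ^ t
          ≡⟨ cong (_* G ^ t) (∑-swap (λ x y → 𝟙 (S? x y)) xs ys) ⟩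
        ∑[ y ∈ ys ] ∑[ x ∈ xs ] 𝟙 (S? x y) * G ^ t
          ≤⟨ *-monoˡ-≤ (G ^ t) (∑-mono ys (count ∘ ys⊆xs)) ⟩
        ∑ ys (λ _ → G) * G ^ t            ≡⟨ cong (_* G ^ t) (∑-const ys G) ⟩
        length ys * G * G ^ t             ≡⟨ *-assoc (length ys) G (G ^ t) ⟩
        length ys * (G * G ^ t)           <⟨ few ⟩
        T * T ^ t                         ∎)

-- Arrays of d permutations of k = 2d - 2 symbols.

module Arrays (f k : ℕ) (k≡e+e : k ≡ suc f + suc f) where

  e d : ℕ
  e = suc f
  d = suc e

  Array : Set
  Array = Vec (Vec (Fin k) k) d

  abstract
    at : Array → Fin d → Fin k → Fin k
    at A r x = lookup (lookup A r) x

    array : (Fin d → Fin k → Fin k) → Array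
    array g = tabulate λ r → tabulate (g r)

    at-array : ∀ g r x → at (array g) r x ≡ g r x
    at-array g r x =
      trans (cong (λ row → lookup row x) (lookup∘tabulate (λ r → tabulate (g r)) r))
          (lookup∘tabulate (g r) x)

  RowsInjective : Array → Set
  RowsInjective A = ∀ r → Inj (at A r)

  abstract
    arrays : List Array
    arrays = allVecs (perms k) d

    arrays-unique : Unique arrays
    arrays-unique = allVecs-unique d (perms-unique k)

    length-arrays : length arrays ≡ (k !) ^ d
    length-arrays = trans (length-allVecs (perms k) d) (cong (_^ d) (length-perms k))

    arrays-rows : ∀ {A} → A ∈ arrays → RowsInjective A
    arrays-rows A∈ r = perms-injective (∈-allVecs⁻ (perms k) A∈ r)

    ∈-arrays : ∀ {A} → RowsInjective A → A ∈ arrays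
    ∈-arrays {A} inj = ∈-allVecs A λ r → ∈-perms (lookup A r) (inj r)

    at-ext : ∀ {A B} → (∀ r x → at A r x ≡ at B r x) → A ≡ B
    at-ext eq = Vec-ext λ r → Vec-ext (eq r)

  -- Tight pairs and how they overlap.

  -- A tight pair is a Hall violator for a further row that avoids all columns of A, because
  -- |P| = d exceeds the number k − |Q| = e of symbols left.
  Tight : Split k d f → Split k e e → Array → Set
  Tight P Q A = ∀ i x → ∃ λ r → at A r (P ⟨ i ⟩) ≡ Q ⟨ x ⟩

  abstract
    tight? : ∀ P Q A → Dec (Tight P Q A)
    tight? P Q A = all? λ i → all? λ x → any? λ r → at A r (P ⟨ i ⟩) ≟F (Q ⟨ x ⟩)

  -- A pair is full iff the columns P form a Latin square; near pairs are the only
  -- ones that can coexist with a tight pair of the inverse array (dual⇒Near).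
  Full Near : Split k d f → Split k e e → Array → Set
  Full P Q A = ∃ λ y → ∀ r → ∃ λ i → at A r (P ⟨ i ⟩) ≡ Q ⟨ y ⟩ᶜ
  Near P Q A = ∃₂ λ y r₀ → ∀ r → r ≢ r₀ → ∃ λ i → at A r (P ⟨ i ⟩) ≡ Q ⟨ y ⟩ᶜ

  abstract
    full? : ∀ P Q A → Dec (Full P Q A)
    full? P Q A = any? λ y → all? λ r → any? λ i → at A r (P ⟨ i ⟩) ≟F (Q ⟨ y ⟩ᶜ)

    near? : ∀ P Q A → Dec (Near P Q A)
    near? P Q A = any? λ y → any? λ r₀ → all? λ r → ¬? (r ≟F r₀) →-dec
      any? λ i → at A r (P ⟨ i ⟩) ≟F (Q ⟨ y ⟩ᶜ)

  -- Sending each of the d columns to a row in which it holds q is injective, since a row contains q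
  -- only once. There are d rows, so every row is reached.
  columns⇒rows : ∀ {A} → RowsInjective A → (P : Split k d f) (q : Fin k) →
    (∀ i → ∃ λ r → at A r (P ⟨ i ⟩) ≡ q) → ∀ r → ∃ λ i → at A r (P ⟨ i ⟩) ≡ q
  columns⇒rows {A} inj P q col r = case injective⇒surjective row-injective r of λ
    { (i , eq) → i , subst (λ r → at A r (P ⟨ i ⟩) ≡ q) eq (proj₂ (col i)) }
    where
    row-injective : Inj (proj₁ ∘ col)
    row-injective {i} {j} eq = inside-injective P (inj (proj₁ (col i))
      (trans (proj₂ (col i)) (sym (trans (cong (λ r → at A r (P ⟨ j ⟩)) eq) (proj₂ (col j))))))

  -- Since d + e = 2e + 1, a d-set and an e-set in a ground set of size k = 2e always meet.
  k<d+e : k < d + e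
  k<d+e = subst (_< d + e) (sym k≡e+e) ≤-refl

  k<d+d : k < d + d
  k<d+d = <-≤-trans k<d+e (+-monoʳ-≤ d (n≤1+n e))

  rows-injective : ∀ {A a b c} (Q : Split k a b) →
    (row : ∀ x → ∃ λ r → at A r c ≡ Q ⟨ x ⟩) → Inj (proj₁ ∘ row)
  rows-injective {A} {c = c} Q row {x} {y} eq = inside-injective Q
    (trans (sym (proj₂ (row x))) (trans (cong (λ r → at A r c) eq) (proj₂ (row y))))

  module _ {A : Array} (inj : RowsInjective A) where

    -- P and P′ have a common column. In it Q and Q′ each occupy e of the d rows, and 2e > d as soon
    -- as f > 0, so they share a cell.
    shared-symbol : ∀ {P P′ Q Q′} → 0 < f → Tight P Q A → Tight P′ Q′ A →
      ∃₂ λ x x′ → Q ⟨ x ⟩ ≡ Q′ ⟨ x′ ⟩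
    shared-symbol {P} {P′} {Q} {Q′} 0<f tight tight′
      with collision k<d+d (inside-injective P) (inside-injective P′)
    ... | i , i′ , eq
      with collision d<e+e (rows-injective Q (tight i)) (rows-injective Q′ (tight′ i′))
      where
      d<e+e : d < e + e
      d<e+e = s≤s (+-mono-≤ 0<f (≤-refl {e}))
    ... | x , x′ , eq′ = x , x′ , (begin
      Q ⟨ x ⟩                             ≡⟨ proj₂ (tight i x) ⟨
      at A (proj₁ (tight i x)) (P ⟨ i ⟩)   ≡⟨ cong (at A _) eq ⟩
      at A (proj₁ (tight i x)) (P′ ⟨ i′ ⟩) ≡⟨ cong (λ r → at A r (P′ ⟨ i′ ⟩)) eq′ ⟩
      at A (proj₁ (tight′ i′ x′)) (P′ ⟨ i′ ⟩) ≡⟨ proj₂ (tight′ i′ x′) ⟩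
      Q′ ⟨ x′ ⟩ ∎)
      where open ≡-Reasoning

    -- A column of P outside P′ makes the complement of P′ nonempty, so f > 0 and there is a shared
    -- symbol. The column holds this symbol in some row, where it also occurs within P′; as a row
    -- has it only once, the column lies in P′.
    tight-columns : ∀ {P P′ Q Q′} → Tight P Q A → Tight P′ Q′ A → P ≡ P′
    tight-columns {P} {P′} {Q} {Q′} tight tight′ = Split-ext P P′ P⊆P′
      where
      P⊆P′ : ∀ i → (P ⟨ i ⟩) ∈ₛ P′
      P⊆P′ i with (P ⟨ i ⟩) ∈ₛ? P′
      ... | yes ∈P′ = ∈P′
      ... | no ∉P′ with shared-symbol (0<f (proj₁ (∉⇒complement P′ _ ∉P′))) tight tight′
        where
        0<f : ∀ {n} → Fin n → 0 < n
        0<f {suc n} _ = s≤s z≤n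
      ... | x , x′ , eq with tight i x
      ... | r , hit with columns⇒rows inj P′ (Q′ ⟨ x′ ⟩) (λ j → tight′ j x′) r
      ... | j , hit′ = j , inj r (trans hit′ (sym (trans hit eq)))

    -- The columns agree. If the symbol sets differ, then some symbol of Q′ outside Q occurs in
    -- every column of P, hence within P in every row, which makes the pair full.
    tight-unique : ∀ {P P′ Q Q′} → Tight P Q A → Tight P′ Q′ A → (P , Q) ≡ (P′ , Q′) ⊎ Full P Q A
    tight-unique {P} {P′} {Q} {Q′} tight tight′ with tight-columns tight tight′
    ... | refl with all? (λ x → (Q′ ⟨ x ⟩) ∈ₛ? Q)
    ... | yes Q′⊆Q = inj₁ (cong (P ,_) (sym (Split-ext Q′ Q Q′⊆Q)))
    ... | no Q′⊈Q with ¬∀⟶∃¬ e _ (λ x → (Q′ ⟨ x ⟩) ∈ₛ? Q) Q′⊈Q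
    ... | x , x∉Q with ∉⇒complement Q _ x∉Q
    ... | y , eq = inj₂ (y , λ r → case columns⇒rows inj P (Q′ ⟨ x ⟩) (λ j → tight′ j x) r of λ
      { (i , hit) → i , trans hit (sym eq) })

    -- The d cells of the first column of P hold the e symbols of Q and one further entry; the row of
    -- the latter determines Q.
    SpareRow : Split k d f × Split k e e → Fin d → Set
    SpareRow (P , Q) r = Tight P Q A ×
      (∀ x → ∃ λ r′ → r′ ≢ r × at A r′ (P ⟨ zero ⟩) ≡ Q ⟨ x ⟩) ×
      (∀ r′ → r′ ≢ r → at A r′ (P ⟨ zero ⟩) ∈ₛ Q)

    tight⇒spareRow : ∀ {P Q} → Tight P Q A → ∃ (SpareRow (P , Q))
    tight⇒spareRow {P} {Q} tight with injective-image (rows-injective Q (tight zero))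
    ... | r , unhit , hit = r , tight ,
      (λ x → proj₁ (tight zero x) , unhit x , proj₂ (tight zero x)) ,
      λ r′ r′≢r → case hit r′ r′≢r of λ { (x , refl) → x , sym (proj₂ (tight zero x)) }

    spareRow-injective : ∀ {s s′ r} → SpareRow s r → SpareRow s′ r → s ≡ s′
    spareRow-injective {P , Q} {P′ , Q′} (tight , row , _) (tight′ , _ , sym∈)
      with tight-columns tight tight′
    ... | refl = cong (P ,_) (Split-ext Q Q′ λ x → case row x of λ
      { (r′ , r′≢r , eq) → subst (_∈ₛ Q′) eq (sym∈ r′ r′≢r) })

  -- Weights of tight pairs.

  -- Chosen so that the weights of the tight pairs of A, together with those of the inverse of A,
  -- sum to at most 2d.
  grade : {F N : Set} → Dec F → Dec N → ℕ
  grade (yes _) _       = 1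
  grade (no _)  (yes _) = d
  grade (no _)  (no _)  = 2 * d

  weight : Array → Split k d f × Split k e e → ℕ
  weight A (P , Q) = 𝟙 (tight? P Q A) * grade (full? P Q A) (near? P Q A)

  pairs : List (Split k d f × Split k e e)
  pairs = cartesianProduct (splits k d f) (splits k e e)

  pairs-unique : Unique pairs
  pairs-unique = Unique.cartesianProduct⁺ (splits-unique k d f) (splits-unique k e e)

  W : Array → ℕ
  W A = ∑ pairs (weight A)

  d≤2d : d ≤ 2 * d
  d≤2d = m≤m+n d (d + 0)

  grade≤2d : {F N : Set} (F? : Dec F) (N? : Dec N) → grade F? N? ≤ 2 * d
  grade≤2d (yes _) _       = s≤s z≤n
  grade≤2d (no _)  (yes _) = d≤2d
  grade≤2d (no _)  (no _)  = ≤-refl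

  grade≤d : {F N : Set} (F? : Dec F) (N? : Dec N) → N → grade F? N? ≤ d
  grade≤d (yes _) _       _ = s≤s z≤n
  grade≤d (no _)  (yes _) _ = ≤-refl
  grade≤d (no _)  (no ¬n) n = contradiction n ¬n

  grade-full : {F N : Set} (F? : Dec F) (N? : Dec N) → F → grade F? N? ≤ 1
  grade-full (yes _) _ _ = ≤-refl
  grade-full (no ¬f) _ f = contradiction f ¬f

  weight-positive : ∀ {A P Q} → 0 < weight A (P , Q) → Tight P Q A
  weight-positive {A} {P} {Q} pos with tight? P Q A
  ... | yes tight = tight

  weight≤grade : ∀ {A P Q} → weight A (P , Q) ≤ grade (full? P Q A) (near? P Q A)
  weight≤grade {A} {P} {Q} with tight? P Q A
  ... | yes _ = ≤-reflexive (*-identityˡ _)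
  ... | no _  = z≤n

  -- If some tight pair is not full, it is the only one by `tight-unique`, and its grade is the
  -- total. Otherwise every tight pair is full and has weight 1; their spare rows are distinct, so
  -- there are at most d of them.
  W≤ : ∀ {A} → RowsInjective A → ∀ {m} → d ≤ m →
    (∀ {P Q} → Tight P Q A → grade (full? P Q A) (near? P Q A) ≤ m) → W A ≤ m
  W≤ {A} inj {m} d≤m bound with Any.any? (λ (P , Q) → tight? P Q A ×-dec ¬? (full? P Q A)) pairs
  ... | yes nonfull with find nonfull
  ... | (P , Q) , s∈ , tight , ¬full = begin
    ∑ pairs (weight A)          ≤⟨ ∑-inject {g = weight A} _≡_ pairs ((P , Q) ∷ []) pairs-unique
                                     (λ _ pos → (P , Q) , here refl , is-only (weight-positive pos) ,
                                         ≤-reflexive (cong (weight A) (is-only (weight-positive pos))))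
                                     (λ { _ _ refl refl → refl }) ⟩
    weight A (P , Q) + 0        ≡⟨ +-identityʳ _ ⟩
    weight A (P , Q)            ≤⟨ weight≤grade {A} ⟩
    grade (full? P Q A) (near? P Q A) ≤⟨ bound tight ⟩
    m                           ∎
    where
    open ≤-Reasoning
    is-only : ∀ {P′ Q′} → Tight P′ Q′ A → (P′ , Q′) ≡ (P , Q)
    is-only tight′ with tight-unique inj tight tight′
    ... | inj₁ eq   = sym eq
    ... | inj₂ full = contradiction full ¬full
  W≤ {A} inj {m} d≤m bound | no ¬nonfull = begin
    ∑ pairs (weight A)          ≤⟨ ∑-inject (SpareRow inj) pairs (allFin d) pairs-unique match
                                     (λ _ _ → spareRow-injective inj) ⟩
    ∑ (allFin d) (λ _ → 1)      ≡⟨ ∑-const (allFin d) 1 ⟩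
    length (allFin d) * 1       ≡⟨ *-identityʳ _ ⟩
    length (allFin d)           ≡⟨ length-tabulate {n = d} id ⟩
    d                           ≤⟨ d≤m ⟩
    m                           ∎
    where
    open ≤-Reasoning
    match : ∀ {s} → s ∈ pairs → 0 < weight A s →
      ∃ λ r → r ∈ allFin d × SpareRow inj s r × weight A s ≤ 1
    match {P , Q} s∈ pos = case tight⇒spareRow inj tight of λ
      { (r , spare) → r , ∈-allFin r , spare ,
        ≤-trans (weight≤grade {A}) (grade-full (full? P Q A) (near? P Q A) full) }
      where
      tight = weight-positive pos
      full  = decidable-stable (full? P Q A) λ ¬full → ¬nonfull (lose s∈ (tight , ¬full))

  -- Duality between an array and its inverse.

  Inverse : Array → Array → Set
  Inverse A B = ∀ r → (∀ x → at B r (at A r x) ≡ x) × (∀ y → at A r (at B r y) ≡ y)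

  -- Read in A, tightness of (P′, Q′) says that every symbol of P′ occurs in every column of Q′.
  -- Being larger than Q, P′ contains a symbol outside Q. It occupies columns of Q′ in e distinct
  -- rows, all but one row `r₀`, and these columns lie in P.
  dual⇒Near : ∀ {A B P Q P′ Q′} → RowsInjective A → RowsInjective B → Inverse A B →
    Tight P Q A → Tight P′ Q′ B → Near P Q A
  dual⇒Near {A} {B} {P} {Q} {P′} {Q′} A-inj B-inj A⁻¹ tight tight′ =
    y , r₀ , λ r r≢r₀ → case hit r r≢r₀ of λ
      { (x , refl) → proj₁ (Q′⊆P x) ,
        trans (cong (at A r) (proj₂ (Q′⊆P x))) (trans (transpose (proj₂ (tight′ i* x))) (sym y-eq)) }
    where
    transpose : ∀ {r x y} → at B r y ≡ x → at A r x ≡ y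
    transpose {r} refl = proj₂ (A⁻¹ r) _

    -- A column common to P and Q′ holds a symbol of P′ in every row, and the given symbol of Q in
    -- some row.
    Q⊆P′ : ∀ x → (Q ⟨ x ⟩) ∈ₛ P′
    Q⊆P′ x with collision k<d+e (inside-injective P) (inside-injective Q′)
    ... | i , x′ , eq with tight i x
    ... | r , hit with columns⇒rows B-inj P′ (Q′ ⟨ x′ ⟩) (λ j → tight′ j x′) r
    ... | j , hit′ = j , trans (sym (transpose hit′)) (trans (cong (at A r) (sym eq)) hit)

    -- The first symbol of Q lies in P′, so the given column of Q′ holds it in some row; in that row
    -- the symbol occurs within P.
    Q′⊆P : ∀ x → (Q′ ⟨ x ⟩) ∈ₛ P
    Q′⊆P x with Q⊆P′ zero
    ... | j , eq with tight′ j x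
    ... | r , hit with columns⇒rows A-inj P (Q ⟨ zero ⟩) (λ i → tight i zero) r
    ... | i , hit′ = i , A-inj r (trans hit′ (sym (trans (transpose hit) eq)))

    extra : ∃ λ i → ¬ ((P′ ⟨ i ⟩) ∈ₛ Q)
    extra with all? (λ i → (P′ ⟨ i ⟩) ∈ₛ? Q)
    ... | yes P′⊆Q = contradiction (injective⇒≤ embed-injective) 1+n≰n
      where
      embed-injective : Inj (proj₁ ∘ P′⊆Q)
      embed-injective {i} {j} eq = inside-injective P′
        (trans (sym (proj₂ (P′⊆Q i))) (trans (cong (Q ⟨_⟩) eq) (proj₂ (P′⊆Q j))))
    ... | no P′⊈Q = ¬∀⟶∃¬ d _ (λ i → (P′ ⟨ i ⟩) ∈ₛ? Q) P′⊈Q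

    i* = proj₁ extra
    y    = proj₁ (∉⇒complement Q (P′ ⟨ i* ⟩) (proj₂ extra))
    y-eq = proj₂ (∉⇒complement Q (P′ ⟨ i* ⟩) (proj₂ extra))
    image = injective-image (rows-injective Q′ (tight′ i*))
    r₀   = proj₁ image
    hit  = proj₂ (proj₂ image)

  -- Good and bad arrays.

  Avoids : Array → Vec (Fin k) k → Set
  Avoids A τ = ∀ r x → at A r x ≢ lookup τ x

  Good : Array → Set
  Good A = Any (Avoids A) (perms k)

  abstract
    good? : ∀ A → Dec (Good A)
    good? A = Any.any? (λ τ → all? λ r → all? λ x → ¬? (at A r x ≟F lookup τ x)) (perms k)

  tight⇒bad : ∀ {A P Q} → Tight P Q A → ¬ Good A
  tight⇒bad {A} {P} {Q} tight good with find good
  ... | τ , τ∈ , avoids = contradiction (injective⇒≤ embed-injective) 1+n≰n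
    where
    τ∉Q : ∀ i → ¬ (lookup τ (P ⟨ i ⟩) ∈ₛ Q)
    τ∉Q i (x , eq) with tight i x
    ... | r , hit = avoids r (P ⟨ i ⟩) (trans hit eq)
    embed : ∀ i → ∃ λ y → Q ⟨ y ⟩ᶜ ≡ lookup τ (P ⟨ i ⟩)
    embed i = ∉⇒complement Q _ (τ∉Q i)
    embed-injective : Inj (proj₁ ∘ embed)
    embed-injective {i} {j} eq = inside-injective P (perms-injective τ∈
      (trans (sym (proj₂ (embed i))) (trans (cong (Q ⟨_⟩ᶜ) eq) (proj₂ (embed j)))))

  -- The default value is returned only when y is not attained.
  preimage : ∀ {m n} (g : Fin m → Fin n) (default : Fin m) → Fin n → Fin m
  preimage g default y with any? (λ x → g x ≟F y)
  ... | yes (x , _) = x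
  ... | no _        = default

  preimage-correct : ∀ {m n} {g : Fin m → Fin n} {default} {y} →
    (∃ λ x → g x ≡ y) → g (preimage g default y) ≡ y
  preimage-correct {g = g} {y = y} hit with any? (λ x → g x ≟F y)
  ... | yes (x , eq) = eq
  ... | no ¬hit      = contradiction hit ¬hit

  invert : ∀ {n} → Vec (Fin n) n → Vec (Fin n) n
  invert p = tabulate λ y → preimage (lookup p) y y

  lookup-invert : ∀ {n} (p : Vec (Fin n) n) → Inj (lookup p) → ∀ y →
    lookup p (lookup (invert p) y) ≡ y
  lookup-invert p inj y = trans (cong (lookup p) (lookup∘tabulate _ y))
    (preimage-correct (injective⇒surjective inj y))

  invert-lookup : ∀ {n} (p : Vec (Fin n) n) → Inj (lookup p) → ∀ x →
    lookup (invert p) (lookup p x) ≡ x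
  invert-lookup p inj x = inj (lookup-invert p inj (lookup p x))

  invert-injective : ∀ {n} (p : Vec (Fin n) n) → Inj (lookup p) → Inj (lookup (invert p))
  invert-injective p inj {x} {y} eq =
    trans (sym (lookup-invert p inj x)) (trans (cong (lookup p) eq) (lookup-invert p inj y))

  inverse : Array → Array
  inverse = Vec.map invert

  abstract
    Inverse-inverse : ∀ {A} → RowsInjective A → Inverse A (inverse A)
    Inverse-inverse {A} inj r rewrite lookup-map r invert A =
      invert-lookup (lookup A r) (inj r) , lookup-invert (lookup A r) (inj r)

  Inverse-sym : ∀ {A B} → Inverse A B → Inverse B A
  Inverse-sym A⁻¹ r = proj₂ (A⁻¹ r) , proj₁ (A⁻¹ r)

  Inverse-injective : ∀ {A B} → Inverse A B → RowsInjective A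
  Inverse-injective {A} {B} A⁻¹ r {x} {y} eq =
    trans (sym (proj₁ (A⁻¹ r) x)) (trans (cong (at B r) eq) (proj₁ (A⁻¹ r) y))

  Inverse-unique : ∀ {A B B′} → Inverse A B → Inverse A B′ → B ≡ B′
  Inverse-unique {A} {B} {B′} B-inv B′-inv = at-ext λ r y →
    trans (cong (at B r) (sym (proj₂ (B′-inv r) y))) (proj₁ (B-inv r) (at B′ r y))

  -- The inverse of a permutation τ avoiding A avoids B: if row r of B and the inverse of τ both
  -- send y to x, then row r of A and τ both send x to y.
  good-inverse : ∀ {A B} → Inverse A B → Good A → Good B
  good-inverse {A} {B} A⁻¹ good with find good
  ... | τ , τ∈ , avoids = lose (∈-perms (invert τ) (invert-injective τ τ-inj)) λ r y eq →
      avoids r (lookup (invert τ) y)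
        (trans (trans (cong (at A r) (sym eq)) (proj₂ (A⁻¹ r) y)) (sym (lookup-invert τ τ-inj y)))
    where τ-inj = perms-injective τ∈

  bad : Array → ℕ
  bad A = 𝟙 (¬? (good? A))

  grades≤2d : ∀ {A P Q} → Tight P Q A → grade (full? P Q A) (near? P Q A) ≤ 2 * d
  grades≤2d {A} {P} {Q} _ = grade≤2d (full? P Q A) (near? P Q A)

  grades≤d : ∀ {A P Q} → Near P Q A → grade (full? P Q A) (near? P Q A) ≤ d
  grades≤d {A} {P} {Q} = grade≤d (full? P Q A) (near? P Q A)

  ≤*bad : ∀ {A} n → ¬ Good A → n ≤ n * bad A
  ≤*bad {A} n ¬good =
    ≤-reflexive (trans (sym (*-identityʳ n)) (cong (n *_) (sym (𝟙-yes (¬? (good? A)) ¬good))))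

  W-positive : ∀ {A} → 0 < W A → ∃₂ λ P Q → Tight P Q A
  W-positive {A} pos = case ∑-positive {f = weight A} pairs pos of λ
    { ((P , Q) , _ , pos′) → P , Q , weight-positive pos′ }

  module _ {A B} (A⁻¹ : Inverse A B) where

    private
      A-inj = Inverse-injective A⁻¹
      B-inj = Inverse-injective (Inverse-sym A⁻¹)

    -- If one weight vanishes, the other is at most 2d. If neither does, `dual⇒Near` makes all tight
    -- pairs on both sides near, and each total is at most d. A positive weight also makes A bad,
    -- through `good-inverse` if it belongs to B. The variables m and n allow matching on the two
    -- weights.
    W-pair≤ : ∀ {m n} → m ≡ W A → n ≡ W B → m + n ≤ 2 * d * bad A
    W-pair≤ {zero}  {zero}  _  _  = z≤n
    W-pair≤ {suc m} {zero}  eq _  = case W-positive {A} (subst (0 <_) eq (s≤s z≤n)) of λ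
      { (P , Q , tight) → ≤-trans (≤-reflexive (trans (+-identityʳ _) eq))
        (≤-trans (W≤ A-inj d≤2d grades≤2d) (≤*bad (2 * d) (tight⇒bad tight))) }
    W-pair≤ {zero}  {suc n} _  eq = case W-positive {B} (subst (0 <_) eq (s≤s z≤n)) of λ
      { (P , Q , tight) → ≤-trans (≤-reflexive eq)
        (≤-trans (W≤ B-inj d≤2d grades≤2d) (≤*bad (2 * d) (tight⇒bad tight ∘ good-inverse A⁻¹))) }
    W-pair≤ {suc m} {suc n} eq eq′ =
      case W-positive {A} (subst (0 <_) eq (s≤s z≤n)) , W-positive {B} (subst (0 <_) eq′ (s≤s z≤n)) of λ
      { ((P , Q , tight) , (P′ , Q′ , tight′)) → ≤-trans
        (+-mono-≤
          (≤-trans (≤-reflexive eq)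
            (W≤ A-inj ≤-refl λ t → grades≤d (dual⇒Near A-inj B-inj A⁻¹ t tight′)))
          (≤-trans (≤-reflexive eq′)
            (W≤ B-inj ≤-refl λ t → grades≤d (dual⇒Near B-inj A-inj (Inverse-sym A⁻¹) t tight))))
        (≤-trans (≤-reflexive (cong (d +_) (sym (+-identityʳ d)))) (≤*bad (2 * d) (tight⇒bad tight))) }

  -- Inversion permutes the arrays, so twice the total weight can be grouped by an array and its
  -- inverse, with contribution at most 2d per bad array.
  ∑W≤d*bad : ∑ arrays W ≤ d * ∑ arrays bad
  ∑W≤d*bad = *-cancelˡ-≤ 2 (begin
    2 * ∑ arrays W                            ≡⟨ cong (∑ arrays W +_) (+-identityʳ _) ⟩
    ∑ arrays W + ∑ arrays W                   ≤⟨ +-monoʳ-≤ (∑ arrays W) W≤W⁻¹ ⟩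
    ∑ arrays W + ∑ arrays (W ∘ inverse)       ≡⟨ ∑-+ W (W ∘ inverse) arrays ⟨
    ∑[ A ∈ arrays ] (W A + W (inverse A))
      ≤⟨ ∑-mono arrays (λ A∈ → W-pair≤ (Inverse-inverse (arrays-rows A∈)) refl refl) ⟩
    ∑[ A ∈ arrays ] (2 * d * bad A)           ≡⟨ ∑-*ˡ (2 * d) bad arrays ⟩
    2 * d * ∑ arrays bad                      ≡⟨ *-assoc 2 d (∑ arrays bad) ⟩
    2 * (d * ∑ arrays bad)                    ∎)
    where
    open ≤-Reasoning
    W≤W⁻¹ : ∑ arrays W ≤ ∑ arrays (W ∘ inverse)
    W≤W⁻¹ = ∑-inject (λ A B → Inverse A B) arrays arrays arrays-unique
      -- The partner of A is its inverse, and the terms agree because inverting twice returns A.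
      (λ {A} A∈ _ → let A⁻¹ = Inverse-inverse {A} (arrays-rows A∈)
                        B-inj = Inverse-injective {inverse A} {A} (Inverse-sym {A} A⁻¹) in
        inverse A , ∈-arrays B-inj , A⁻¹ ,
        ≤-reflexive (cong W (Inverse-unique {inverse A} {A} (Inverse-sym {A} A⁻¹)
            (Inverse-inverse {inverse A} B-inj))))
      (λ {A} {A′} {B} _ _ p q → Inverse-unique {B} (Inverse-sym {A} p) (Inverse-sym {A′} q))

  -- Arrays with a given tight pair, built from Latin squares.

  length-allFin : ∀ n → length (allFin n) ≡ n
  length-allFin n = length-tabulate {n = n} id

  -- A filling (L , c , p) describes an array with a given tight pair (P , Q).  The symbol 0 of the
  -- Latin square L marks in each row r the cell of P that holds the c_r-th symbol outside Q; p_r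
  -- arranges the remaining symbols on the complement of P.
  Filling : Set
  Filling = Square d × Vec (Fin e) d × Vec (Vec (Fin f) f) d

  Latin : Square d → Set
  Latin L = (∀ r → Inj (entry L r)) × (∀ i → Inj (λ r → entry L r i))

  abstract
    latins : List (Square d)
    latins = filter (λ s → isLatin s ≟B true) (allSquares d)

    latins-unique : Unique latins
    latins-unique = Unique.filter⁺ (λ s → isLatin s ≟B true)
      (allVecs-unique d (allVecs-unique d (Unique.allFin⁺ d)))

    latins-sound : ∀ {L} → L ∈ latins → Latin L
    latins-sound {L} L∈ =
      isLatin-sound L (proj₂ (∈-filter⁻ (λ s → isLatin s ≟B true) {xs = allSquares d} L∈))

    length-latins : length latins ≡ NLatin d
    length-latins = refl

    heads : List (Vec (Fin e) d)
    heads = allVecs (allFin e) d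

    heads-unique : Unique heads
    heads-unique = allVecs-unique d (Unique.allFin⁺ e)

    length-heads : length heads ≡ e ^ d
    length-heads = trans (length-allVecs (allFin e) d) (cong (_^ d) (length-allFin e))

    tails : List (Vec (Vec (Fin f) f) d)
    tails = allVecs (perms f) d

    tails-unique : Unique tails
    tails-unique = allVecs-unique d (perms-unique f)

    tails-sound : ∀ {p} → p ∈ tails → ∀ r → Inj (lookup (lookup p r))
    tails-sound p∈ r = perms-injective (∈-allVecs⁻ (perms f) p∈ r)

    length-tails : length tails ≡ (f !) ^ d
    length-tails = trans (length-allVecs (perms f) d) (cong (_^ d) (length-perms f))

  fillings : List Filling
  fillings = cartesianProduct latins (cartesianProduct heads tails)

  fillings-unique : Unique fillings
  fillings-unique =
    Unique.cartesianProduct⁺ latins-unique (Unique.cartesianProduct⁺ heads-unique tails-unique)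

  fillings-sound : ∀ {L c p} → (L , c , p) ∈ fillings → Latin L × (∀ r → Inj (lookup (lookup p r)))
  fillings-sound F∈ = case ∈-cartesianProduct⁻ latins (cartesianProduct heads tails) F∈ of λ
    { (L∈ , cp∈) → latins-sound L∈ , tails-sound (proj₂ (∈-cartesianProduct⁻ heads tails cp∈)) }

  place : Fin e → Fin d → Fin e ⊎ Fin e
  place c zero    = inj₂ c
  place c (suc x) = inj₁ x

  -- A row in the coordinates of the two splits. The cell marked 0 receives the outside symbol c,
  -- and `punchIn c` spreads the other f outside symbols over the f columns outside P.
  fill : (Fin d → Fin d) → Fin e → (Fin f → Fin f) → Fin d ⊎ Fin f → Fin e ⊎ Fin e
  fill ρ c p (inj₁ i) = place c (ρ i)
  fill ρ c p (inj₂ z) = inj₂ (punchIn c (p z))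

  place-injective : ∀ c → Inj (place c)
  place-injective c {zero}  {zero}  _    = refl
  place-injective c {suc x} {suc y} refl = refl

  place≢rest : ∀ c x z → place c x ≢ inj₂ (punchIn c z)
  place≢rest c zero z eq = punchInᵢ≢i c z (sym (inj₂-injective eq))

  place-outside : ∀ c x {y} → place c x ≡ inj₂ y → c ≡ y
  place-outside c zero eq = inj₂-injective eq

  place-cancel : ∀ c c′ x x′ → place c x ≡ place c′ x′ → x ≡ x′
  place-cancel c c′ zero    zero    _    = refl
  place-cancel c c′ (suc x) (suc y) refl = refl

  fill-injective : ∀ {ρ c p} → Inj ρ → Inj p → Inj (fill ρ c p)
  fill-injective {c = c} ρ-inj p-inj {inj₁ i} {inj₁ j} eq = cong inj₁ (ρ-inj (place-injective c eq))
  fill-injective {c = c} ρ-inj p-inj {inj₁ i} {inj₂ z} eq = contradiction eq (place≢rest c _ _)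
  fill-injective {c = c} ρ-inj p-inj {inj₂ z} {inj₁ i} eq = contradiction (sym eq) (place≢rest c _ _)
  fill-injective {c = c} ρ-inj p-inj {inj₂ z} {inj₂ w} eq =
    cong inj₂ (p-inj (punchIn-injective c _ _ (inj₂-injective eq)))

  -- The heads agree because an injective endomap of Fin d attains zero.
  fill-cancel : ∀ {ρ ρ′ c c′ p p′} → Inj ρ → (∀ i → fill ρ c p i ≡ fill ρ′ c′ p′ i) →
    (∀ i → ρ i ≡ ρ′ i) × c ≡ c′ × (∀ z → p z ≡ p′ z)
  fill-cancel {ρ} {ρ′} {c} {c′} {p} {p′} ρ-inj eq = ρ≡ , c≡ , p≡
    where
    ρ≡ : ∀ i → ρ i ≡ ρ′ i
    ρ≡ i = place-cancel c c′ _ _ (eq (inj₁ i))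
    c≡ : c ≡ c′
    c≡ = case injective⇒surjective ρ-inj zero of λ { (i , ρi≡0) →
      inj₂-injective (trans (sym (cong (place c) ρi≡0))
        (trans (eq (inj₁ i)) (cong (place c′) (trans (sym (ρ≡ i)) ρi≡0)))) }
    p≡ : ∀ z → p z ≡ p′ z
    p≡ z = punchIn-injective c _ _
      (trans (inj₂-injective (eq (inj₂ z))) (cong (λ c → punchIn c (p′ z)) (sym c≡)))

  -- The head lists the outside symbol used within P in each row; these are the traces left on it by
  -- `Full` and `Near`.
  ConstantHead NearConstantHead : Vec (Fin e) d → Set
  ConstantHead c     = ∃ λ y → ∀ r → lookup c r ≡ y
  NearConstantHead c = ∃₂ λ y r₀ → ∀ r → r ≢ r₀ → lookup c r ≡ y

  abstract
    constant? : ∀ c → Dec (ConstantHead c)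
    constant? c = any? λ y → all? λ r → lookup c r ≟F y

  abstract
    nearConstant? : ∀ c → Dec (NearConstantHead c)
    nearConstant? c = any? λ y → any? λ r₀ → all? λ r → ¬? (r ≟F r₀) →-dec (lookup c r ≟F y)

  headGrade : Vec (Fin e) d → ℕ
  headGrade c = grade (constant? c) (nearConstant? c)

  -- The grade decreases as more properties hold, so implications from the array to its head bound
  -- the grade of the array from below.
  grade-mono : ∀ {F F′ N N′ : Set} (F? : Dec F) (F′? : Dec F′) (N? : Dec N) (N′? : Dec N′) →
    (F → F′) → (N → N′) → grade F′? N′? ≤ grade F? N?
  grade-mono (yes f) (no ¬f) _       _       F⇒ N⇒ = contradiction (F⇒ f) ¬f
  grade-mono (yes _) (yes _) _       _       F⇒ N⇒ = ≤-refl
  grade-mono (no _)  F′?     (no _)  N′?     F⇒ N⇒ = grade≤2d F′? N′?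
  grade-mono (no _)  F′?     (yes n) N′?     F⇒ N⇒ = grade≤d F′? N′? (N⇒ n)

  module _ (P : Split k d f) (Q : Split k e e) where

    fillRow : Filling → Fin d → Fin d ⊎ Fin f → Fin e ⊎ Fin e
    fillRow (L , c , p) r = fill (entry L r) (lookup c r) (lookup (lookup p r))

    build : Filling → Array
    build F = array λ r x → enum Q (fillRow F r (index P x))

    at-build : ∀ F r x → at (build F) r x ≡ enum Q (fillRow F r (index P x))
    at-build F r x = at-array _ r x

    at-build-enum : ∀ F r i → at (build F) r (enum P i) ≡ enum Q (fillRow F r i)
    at-build-enum F r i = trans (at-build F r (enum P i)) (cong (enum Q ∘ fillRow F r) (index-enum P i))

    build-rows : ∀ {F} → F ∈ fillings → RowsInjective (build F)
    build-rows {F} F∈ r {x} {y} eq = case fillings-sound F∈ of λ { ((rows , _) , p-inj) →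
      index-injective P (fill-injective (rows r) (p-inj r)
        (enum-injective Q (trans (sym (at-build F r x)) (trans eq (at-build F r y))))) }

    -- Each column of a Latin square contains every symbol, and the Latin symbol `suc x` stands for
    -- the x-th symbol of Q.
    build-tight : ∀ {F} → F ∈ fillings → Tight P Q (build F)
    build-tight {F@(L , c , p)} F∈ i x =
      case injective⇒surjective (proj₂ (proj₁ (fillings-sound F∈)) i) (suc x) of λ
        { (r , eq) → r , trans (at-build-enum F r (inj₁ i)) (cong (enum Q ∘ place (lookup c r)) eq) }

    head-outside : ∀ F {r i y} → at (build F) r (P ⟨ i ⟩) ≡ Q ⟨ y ⟩ᶜ → lookup (proj₁ (proj₂ F)) r ≡ y
    head-outside F@(L , c , p) {r} {i} eq = place-outside (lookup c r) (entry L r i)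
      (enum-injective Q (trans (sym (at-build-enum F r (inj₁ i))) eq))

    build-full : ∀ F → Full P Q (build F) → ConstantHead (proj₁ (proj₂ F))
    build-full F (y , hit) = y , λ r → head-outside F (proj₂ (hit r))

    build-near : ∀ F → Near P Q (build F) → NearConstantHead (proj₁ (proj₂ F))
    build-near F (y , r₀ , hit) = y , r₀ , λ r r≢r₀ → head-outside F (proj₂ (hit r r≢r₀))

    build-injective : ∀ {F F′} → F ∈ fillings → build F ≡ build F′ → F ≡ F′
    build-injective {F@(L , c , p)} {F′@(L′ , c′ , p′)} F∈ eq =
      cong₂ _,_ (Vec-ext λ r → Vec-ext (proj₁ (cancel r)))
        (cong₂ _,_ (Vec-ext (proj₁ ∘ proj₂ ∘ cancel)) (Vec-ext λ r → Vec-ext (proj₂ (proj₂ (cancel r)))))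
      where
      same : ∀ r i → fillRow F r i ≡ fillRow F′ r i
      same r i = enum-injective Q (trans (sym (at-build-enum F r i))
        (trans (cong (λ A → at A r (enum P i)) eq) (at-build-enum F′ r i)))
      cancel : ∀ r → _
      cancel r = fill-cancel (proj₁ (proj₁ (fillings-sound F∈)) r) (same r)

    weight-build : ∀ {F} → F ∈ fillings → headGrade (proj₁ (proj₂ F)) ≤ weight (build F) (P , Q)
    weight-build {F} F∈ = begin
      headGrade (proj₁ (proj₂ F))
        ≤⟨ grade-mono (full? P Q (build F)) (constant? _) (near? P Q (build F)) (nearConstant? _)
             (build-full F) (build-near F) ⟩
      grade (full? P Q (build F)) (near? P Q (build F))
        ≡⟨ *-identityˡ _ ⟨
      1 * grade (full? P Q (build F)) (near? P Q (build F))
        ≡⟨ cong (_* grade (full? P Q (build F)) (near? P Q (build F)))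
            (𝟙-yes (tight? P Q (build F)) (build-tight F∈)) ⟨
      weight (build F) (P , Q) ∎
      where open ≤-Reasoning

    ∑-fillings : ∑ fillings (headGrade ∘ proj₁ ∘ proj₂) ≡ NLatin d * (∑ heads headGrade * (f !) ^ d)
    ∑-fillings = begin
      ∑ fillings (headGrade ∘ proj₁ ∘ proj₂)
        ≡⟨ ∑-cartesianProduct _ latins _ ⟩
      ∑ latins (λ _ → ∑ (cartesianProduct heads tails) (headGrade ∘ proj₁))
        ≡⟨ ∑-const latins _ ⟩
      length latins * ∑ (cartesianProduct heads tails) (headGrade ∘ proj₁)
        ≡⟨ cong₂ _*_ length-latins (∑-cartesianProduct _ heads tails) ⟩
      NLatin d * ∑[ c ∈ heads ] ∑ tails (λ _ → headGrade c)
        ≡⟨ cong (NLatin d *_) (∑-cong heads λ {c} _ → trans (∑-const tails (headGrade c))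
            (cong (_* headGrade c) length-tails)) ⟩
      NLatin d * ∑[ c ∈ heads ] ((f !) ^ d * headGrade c)
        ≡⟨ cong (NLatin d *_) (∑-*ˡ ((f !) ^ d) headGrade heads) ⟩
      NLatin d * ((f !) ^ d * ∑ heads headGrade)
        ≡⟨ cong (NLatin d *_) (*-comm ((f !) ^ d) _) ⟩
      NLatin d * (∑ heads headGrade * (f !) ^ d) ∎
      where open ≡-Reasoning

    -- Distinct fillings build distinct arrays, each giving the pair weight at least the grade of
    -- its head. The sum factors because that grade depends on the head alone.
    weights≥ : NLatin d * (∑ heads headGrade * (f !) ^ d) ≤ ∑[ A ∈ arrays ] weight A (P , Q)
    weights≥ = subst (_≤ ∑[ A ∈ arrays ] weight A (P , Q)) ∑-fillings
        (∑-inject {g = λ A → weight A (P , Q)} (λ F A → F ∈ fillings × build F ≡ A)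
          fillings arrays fillings-unique
      (λ {F} F∈ _ → build F , ∈-arrays (build-rows F∈) , (F∈ , refl) , weight-build F∈)
      (λ { F∈ _ (_ , refl) (_ , eq) → build-injective F∈ (sym eq) }))

  ∑W≥ : (k C d) * (k C e) * (NLatin d * (∑ heads headGrade * (f !) ^ d)) ≤ ∑ arrays W
  ∑W≥ = begin
    (k C d) * (k C e) * X             ≡⟨ cong (_* X) (sym length-pairs) ⟩
    length pairs * X                  ≡⟨ ∑-const pairs X ⟨
    ∑ pairs (λ _ → X)                 ≤⟨ ∑-mono pairs (λ {(P , Q)} _ → weights≥ P Q) ⟩
    ∑[ s ∈ pairs ] ∑[ A ∈ arrays ] weight A s ≡⟨ ∑-swap (λ s A → weight A s) pairs arrays ⟩
    ∑ arrays W                        ∎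
    where
    open ≤-Reasoning
    X = NLatin d * (∑ heads headGrade * (f !) ^ d)
    length-pairs : length pairs ≡ (k C d) * (k C e)
    length-pairs = trans (length-cartesianProduct (splits k d f) (splits k e e))
      (cong₂ _*_ (length-splits k d f (trans k≡e+e (+-suc e f))) (length-splits k e e k≡e+e))

  -- Total grade of all heads.

  deviates? : ∀ c → Dec (NearConstantHead c × ¬ ConstantHead c)
  deviates? c = nearConstant? c ×-dec ¬? (constant? c)

  private
    lemma : ∀ m n → m * 1 + n * 0 ≡ m
    lemma m n = trans (cong₂ _+_ (*-identityʳ m) (*-zeroʳ n)) (+-identityʳ m)

  -- Constant heads lose 2d - 1 from the maximal grade 2d and deviating ones lose d, so it suffices
  -- to bound the numbers of these heads from above.
  headGrade-complement : ∀ c →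
    headGrade c + ((2 * d ∸ 1) * 𝟙 (constant? c) + d * 𝟙 (deviates? c)) ≡ 2 * d
  headGrade-complement c with constant? c | nearConstant? c
  ... | yes _ | yes _ = cong suc (lemma (2 * d ∸ 1) d)
  ... | yes _ | no _  = cong suc (lemma (2 * d ∸ 1) d)
  ... | no _  | yes _ = trans (cong₂ (λ m n → d + (m + n)) (*-zeroʳ (2 * d ∸ 1)) (*-identityʳ d))
      (cong (d +_) (sym (+-identityʳ d)))
  ... | no _  | no _  = trans (cong₂ (λ m n → 2 * d + (m + n)) (*-zeroʳ (2 * d ∸ 1)) (*-zeroʳ d))
      (+-identityʳ (2 * d))

  heads-constant : ∑ heads (𝟙 ∘ constant?) ≤ e
  heads-constant = begin
    ∑ heads (𝟙 ∘ constant?)  ≤⟨ ∑-inject (λ c y → ∀ r → lookup c r ≡ y) heads (allFin e)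
                                  heads-unique
                                  (λ {c} _ pos → case 𝟙-positive (constant? c) pos of λ
                                    { (y , eq) → y , ∈-allFin y , eq , 𝟙≤1 (constant? c) })
                                  (λ _ _ p q → Vec-ext λ r → trans (p r) (sym (q r))) ⟩
    ∑ (allFin e) (λ _ → 1)   ≡⟨ ∑-const (allFin e) 1 ⟩
    length (allFin e) * 1    ≡⟨ *-identityʳ _ ⟩
    length (allFin e)        ≡⟨ length-allFin e ⟩
    e                        ∎
    where open ≤-Reasoning

  -- The common value, the exceptional row, and the value there, coded by `punchIn` as one of the f
  -- values other than the common one.
  Deviation : Set
  Deviation = Fin e × Fin d × Fin f

  deviations : List Deviation
  deviations = cartesianProduct (allFin e) (cartesianProduct (allFin d) (allFin f))

  DeviatesBy : Vec (Fin e) d → Deviation → Set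
  DeviatesBy c (y , r₀ , z) = (∀ r → r ≢ r₀ → lookup c r ≡ y) × lookup c r₀ ≡ punchIn y z

  deviation : ∀ {c} → NearConstantHead c × ¬ ConstantHead c → ∃ (DeviatesBy c)
  deviation {c} ((y , r₀ , eq) , ¬const) = (y , r₀ , punchOut y≢) , eq , sym (punchIn-punchOut y≢)
    where
    y≢ : y ≢ lookup c r₀
    y≢ y≡ = ¬const (y , λ r → case r ≟F r₀ of λ { (yes refl) → sym y≡ ; (no r≢r₀) → eq r r≢r₀ })

  DeviatesBy-injective : ∀ {c c′ δ} → DeviatesBy c δ → DeviatesBy c′ δ → c ≡ c′
  DeviatesBy-injective {δ = y , r₀ , z} (p , p₀) (q , q₀) = Vec-ext λ r → case r ≟F r₀ of λ
    { (yes refl) → trans p₀ (sym q₀) ; (no r≢r₀) → trans (p r r≢r₀) (sym (q r r≢r₀)) }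

  heads-deviating : ∑ heads (𝟙 ∘ deviates?) ≤ e * (d * f)
  heads-deviating = begin
    ∑ heads (𝟙 ∘ deviates?)  ≤⟨ ∑-inject DeviatesBy heads deviations
                                  heads-unique
                                  (λ {c} _ pos → case deviation {c} (𝟙-positive (deviates? c) pos) of λ
                                    { ((y , r₀ , z) , dev) → (y , r₀ , z) ,
                                      ∈-cartesianProduct⁺ (∈-allFin y)
                                          (∈-cartesianProduct⁺ (∈-allFin r₀) (∈-allFin z)) ,
                                      dev , 𝟙≤1 (deviates? c) })
                                  (λ {c} {c′} _ _ → DeviatesBy-injective {c} {c′}) ⟩
    ∑ deviations (λ _ → 1)   ≡⟨ ∑-const deviations 1 ⟩
    length deviations * 1    ≡⟨ *-identityʳ _ ⟩
    length deviations
      ≡⟨ length-cartesianProduct (allFin e) (cartesianProduct (allFin d) (allFin f)) ⟩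
    length (allFin e) * length (cartesianProduct (allFin d) (allFin f))
                             ≡⟨ cong₂ _*_ (length-allFin e)
                                 (trans (length-cartesianProduct (allFin d) (allFin f))
                                   (cong₂ _*_ (length-allFin d) (length-allFin f))) ⟩
    e * (d * f)              ∎
    where open ≤-Reasoning

  heads-grade : e ^ d * (2 * d) ≤ ∑ heads headGrade + ((2 * d ∸ 1) * e + d * (e * (d * f)))
  heads-grade = begin
    e ^ d * (2 * d)
      ≡⟨ cong (_* (2 * d)) length-heads ⟨
    length heads * (2 * d)
      ≡⟨ ∑-const heads (2 * d) ⟨
    ∑ heads (λ _ → 2 * d)
      ≡⟨ ∑-cong heads (λ {c} _ → headGrade-complement c) ⟨
    ∑[ c ∈ heads ] (headGrade c + ((2 * d ∸ 1) * 𝟙 (constant? c) + d * 𝟙 (deviates? c)))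
      ≡⟨ ∑-+ headGrade _ heads ⟩
    ∑ heads headGrade + ∑[ c ∈ heads ] ((2 * d ∸ 1) * 𝟙 (constant? c) + d * 𝟙 (deviates? c))
      ≡⟨ cong (∑ heads headGrade +_) (trans (∑-+ _ _ heads)
          (cong₂ _+_ (∑-*ˡ (2 * d ∸ 1) _ heads) (∑-*ˡ d _ heads))) ⟩
    ∑ heads headGrade + ((2 * d ∸ 1) * ∑ heads (𝟙 ∘ constant?) + d * ∑ heads (𝟙 ∘ deviates?))
      ≤⟨ +-monoʳ-≤ (∑ heads headGrade)
          (+-mono-≤ (*-monoʳ-≤ (2 * d ∸ 1) heads-constant) (*-monoʳ-≤ d heads-deviating)) ⟩
    ∑ heads headGrade + ((2 * d ∸ 1) * e + d * (e * (d * f))) ∎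
    where open ≤-Reasoning

  -- Covers of the complete bipartite graph given by arrays.

  _·_ : Array → Array → Array
  σ · π = array λ r a → at σ r (at π r a)

  at-· : ∀ σ π r a → at (σ · π) r a ≡ at σ r (at π r a)
  at-· σ π = at-array _

  ·-rows : ∀ {σ π} → RowsInjective σ → RowsInjective π → RowsInjective (σ · π)
  ·-rows {σ} {π} σ-inj π-inj r {a} {b} eq =
    π-inj r (σ-inj r (trans (sym (at-· σ π r a)) (trans eq (at-· σ π r b))))

  ·-cancelʳ : ∀ {σ σ′ π} → RowsInjective π → σ · π ≡ σ′ · π → σ ≡ σ′
  ·-cancelʳ {σ} {σ′} {π} π-inj eq = at-ext λ r y → case injective⇒surjective (π-inj r) y of λ
    { (a , refl) → trans (sym (at-· σ π r a)) (trans (cong (λ A → at A r a) eq) (at-· σ′ π r a)) }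

  #good #bad : ℕ
  #good = ∑[ A ∈ arrays ] 𝟙 (good? A)
  #bad  = ∑ arrays bad

  #good+#bad : #good + #bad ≡ (k !) ^ d
  #good+#bad = trans (sym (∑-+ (𝟙 ∘ good?) bad arrays))
    (trans (∑-cong arrays λ {A} _ → one (good? A))
      (trans (∑-const arrays 1) (trans (*-identityʳ _) length-arrays)))
    where
    one : ∀ {P : Set} (P? : Dec P) → 𝟙 P? + 𝟙 (¬? P?) ≡ 1
    one (yes _) = refl
    one (no _)  = refl

  -- Right multiplication by a fixed π is injective on arrays, so every candidate π survives at most
  -- as many choices σ as there are good arrays.
  good-count : ∀ {π} → π ∈ arrays → ∑[ σ ∈ arrays ] 𝟙 (good? (σ · π)) ≤ #good
  good-count {π} π∈ = ∑-inject (λ σ A → σ · π ≡ A) arrays arrays arrays-unique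
    (λ {σ} σ∈ _ → σ · π , ∈-arrays (·-rows (arrays-rows σ∈) (arrays-rows π∈)) , refl , ≤-refl)
    (λ _ _ eq eq′ → ·-cancelʳ (arrays-rows π∈) (trans eq (sym eq′)))

  module _ {t : ℕ} (σ : Fin t → Array) (σ-rows : ∀ b → RowsInjective (σ b)) where

    Edge : V (K d t) → Fin k → V (K d t) → Fin k → Set
    Edge (inj₁ i) x (inj₁ j) y = ⊥
    Edge (inj₁ i) x (inj₂ b) y = at (σ b) i x ≡ y
    Edge (inj₂ b) y (inj₁ i) x = at (σ b) i x ≡ y
    Edge (inj₂ b) x (inj₂ c) y = ⊥

    cover : Cover (K d t) k
    cover = record
      { E         = Edge
      ; symmetric = λ { (inj₁ _) _ (inj₂ _) _ eq → eq ; (inj₂ _) _ (inj₁ _) _ eq → eq }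
      ; indep     = λ { (inj₁ _) _ _ () ; (inj₂ _) _ _ () }
      ; nonadj    = λ { (inj₁ _) _ (inj₂ _) _ ¬adj _ → ¬adj _ ; (inj₂ _) _ (inj₁ _) _ ¬adj _ → ¬adj _ }
      ; matching  = λ { (inj₁ _) _ (inj₂ _) _ _ _ eq eq′ → trans (sym eq) eq′
                      ; (inj₂ b) _ (inj₁ i) _ _ _ eq eq′ → σ-rows b i (trans eq (sym eq′)) }
      }

    -- Index columns by the colourings a. The colours on the side of size d form π, so column a of
    -- `σ b · π` lists the colours forbidden to b in colouring a. The colours of b itself form a
    -- permutation avoiding these columns.
    packing⇒good : HasPacking cover → ∃ λ π → π ∈ arrays × (∀ b → Good (σ b · π))
    packing⇒good (c , colouring , disjoint) = π , ∈-arrays π-rows , good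
      where
      c-injective : ∀ v → Inj (λ a → c a v)
      c-injective v {a} {b} eq = decidable-stable (a ≟F b) λ a≢b → disjoint a b a≢b v eq
      π : Array
      π = array λ i a → c a (inj₁ i)
      at-π : ∀ i a → at π i a ≡ c a (inj₁ i)
      at-π = at-array _
      π-rows : RowsInjective π
      π-rows i {a} {b} eq = c-injective (inj₁ i) (trans (sym (at-π i a)) (trans eq (at-π i b)))
      good : ∀ b → Good (σ b · π)
      good b = lose {x = τ} (∈-perms τ τ-inj) λ i a eq → colouring a (inj₁ i) (inj₂ b)
        (trans (cong (at (σ b) i) (sym (at-π i a)))
          (trans (sym (at-· (σ b) π i a)) (trans eq (lookup∘tabulate _ a))))
        where
        τ = tabulate λ a → c a (inj₂ b)
        τ-inj : Inj (lookup τ)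
        τ-inj {a} {a′} eq = c-injective (inj₂ b)
          (trans (sym (lookup∘tabulate _ a)) (trans eq (lookup∘tabulate _ a′)))

  -- The choices σ and the candidates π both range over all arrays. Once every π is eliminated, the
  -- cover given by the σ contradicts `packing⇒good`.
  unpackable : ∀ t → (k !) ^ d * ((k !) ^ d ∸ #bad) ^ t < ((k !) ^ d) ^ t → ¬ PackingProperty (K d t) k
  unpackable t few pack = case no-survivors arrays nonempty (λ σ π → good? (σ · π))
      #good good-count t arrays (λ A∈ → A∈) few′ of λ
    { (σ , σ∈ , none) → case packing⇒good σ (arrays-rows ∘ σ∈) (pack (cover σ (arrays-rows ∘ σ∈))) of λ
      { (π , π∈ , good) → none π π∈ good } }
    where
    nonempty : 0 < length arrays
    nonempty = subst (0 <_) (sym length-arrays) (m^n>0 (k !) {{k !≢0}} d)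
    few′ : length arrays * #good ^ t < length arrays ^ t
    few′ = subst₂ (λ T G → T * G ^ t < T ^ t) (sym length-arrays)
      (trans (cong (_∸ #bad) (sym #good+#bad)) (m+n∸n≡m #good #bad)) few

-- Comparison of the number of bad arrays with the threshold.

^-distribʳ-* : ∀ o m n → (m * n) ^ o ≡ m ^ o * n ^ o
^-distribʳ-* zero    m n = refl
^-distribʳ-* (suc o) m n =
  trans (cong (m * n *_) (^-distribʳ-* o m n)) (interchange m n (m ^ o) (n ^ o))
  where
  interchange : ∀ a b c d → a * b * (c * d) ≡ a * c * (b * d)
  interchange = solve-∀

-- With e = f + 1 and d = f + 2, the total deficit of the heads is d times the coefficient (d -
-- 1)²(d - 1 + 1/d) occurring in y(d).
grade-deficit : ∀ f →
  (2 * suc (suc f) ∸ 1) * suc f + suc (suc f) * (suc f * (suc (suc f) * f))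
    ≡ suc f * suc f * (suc (suc f) * suc f + 1)
grade-deficit f = lemma f
  where
  -- The truncated subtraction is replaced by its normal form, which leaves a semiring identity.
  lemma : ∀ f → (suc f + (suc (suc f) + 0)) * suc f + suc (suc f) * (suc f * (suc (suc f) * f))
    ≡ suc f * suc f * (suc (suc f) * suc f + 1)
  lemma = solve-∀

open ExponentialBound using (ℕ→ℚ-+; ℕ→ℚ-*; ℕ→ℚ-mono-≤; ℕ→ℚ-mono-<; 0≤ℕ→ℚ; unit-fraction; *-mono;
  M^d*[T∸B]^t<T^t)

module _ (f : ℕ) where

  private
    e d k : ℕ
    e = suc f
    d = suc e
    k = 2 * d ∸ 2

    k≡e+e : k ≡ e + e
    k≡e+e = trans (cong (λ n → f + suc (suc n)) (+-identityʳ f)) (+-suc f (suc f))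

  open Arrays f k k≡e+e using (arrays; bad; W; ∑W≤d*bad; heads; headGrade; heads-grade; ∑W≥;
    #bad; #good; #good+#bad; unpackable)

  private
    F H N : ℕ
    F = (f !) ^ d
    H = ∑ heads headGrade
    N = NLatin d * (k C d) * (k C e)

  N*H*F≤d*#bad : N * (H * F) ≤ d * #bad
  N*H*F≤d*#bad = begin
    N * (H * F)                                   ≡⟨ lemma (NLatin d) (k C d) (k C e) (H * F) ⟩
    (k C d) * (k C e) * (NLatin d * (H * F))      ≤⟨ ∑W≥ ⟩
    ∑ arrays W                                    ≤⟨ ∑W≤d*bad ⟩
    d * #bad                                      ∎
    where
    open ≤-Reasoning
    lemma : ∀ a b c x → a * b * c * x ≡ b * c * (a * x)
    lemma a b c x = trans (cong (_* x) (trans (*-assoc a b c) (*-comm a (b * c)))) (*-assoc (b * c) a x)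

  -- Since e! = e · f!, the power (e!)^d counts pairs of a head and a tail, and `heads-grade`
  -- applies to the factor e^d.
  head-sum : 2 * d * (e !) ^ d ≤ H * F + e * e * (d * e + 1) * F
  head-sum = begin
    2 * d * (e * f !) ^ d       ≡⟨ cong (2 * d *_) (^-distribʳ-* d e (f !)) ⟩
    2 * d * (e ^ d * F)         ≡⟨ *-assoc (2 * d) (e ^ d) F ⟨
    2 * d * e ^ d * F           ≡⟨ cong (_* F) (*-comm (2 * d) (e ^ d)) ⟩
    e ^ d * (2 * d) * F         ≤⟨ *-monoˡ-≤ F heads-grade ⟩
    (H + ((2 * d ∸ 1) * e + d * (e * (d * f)))) * F ≡⟨ cong (λ n → (H + n) * F) (grade-deficit f) ⟩
    (H + e * e * (d * e + 1)) * F ≡⟨ *-distribʳ-+ F H _ ⟩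
    H * F + e * e * (d * e + 1) * F ∎
    where open ≤-Reasoning

  -- The factor d clears the fraction 1/d, and it matches the factor d in `N*H*F≤d*#bad`.
  d*yFactor≤ : ℕ→ℚ d ℚ.* yFactor d ℚ.≤ ℕ→ℚ (H * F)
  d*yFactor≤ = begin
    ℕ→ℚ d ℚ.* yFactor d
      ≡⟨ solve 7 (λ D two X E E² U F′ →
           D :* (two :* X :- E² :* (E :+ U) :* F′) := two :* D :* X :- E² :* (D :* E :+ U :* D) :* F′)
           refl (ℕ→ℚ d) (ℕ→ℚ 2) (ℕ→ℚ ((e !) ^ d)) (ℕ→ℚ e) (ℕ→ℚ (e * e)) (ℤ.+ 1 / d) (ℕ→ℚ F) ⟩
    ℕ→ℚ 2 ℚ.* ℕ→ℚ d ℚ.* ℕ→ℚ ((e !) ^ d)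
        ℚ.- ℕ→ℚ (e * e) ℚ.* (ℕ→ℚ d ℚ.* ℕ→ℚ e ℚ.+ ℤ.+ 1 / d ℚ.* ℕ→ℚ d) ℚ.* ℕ→ℚ F
      ≡⟨ cong₂ ℚ._-_ eq₁ eq₂ ⟩
    ℕ→ℚ (2 * d * (e !) ^ d) ℚ.- ℕ→ℚ (e * e * (d * e + 1) * F)
      ≤⟨ ℚ.+-monoˡ-≤ (ℚ.- ℕ→ℚ (e * e * (d * e + 1) * F)) (ℕ→ℚ-mono-≤ head-sum) ⟩
    ℕ→ℚ (H * F + e * e * (d * e + 1) * F) ℚ.- ℕ→ℚ (e * e * (d * e + 1) * F)
      ≡⟨ cong (ℚ._- ℕ→ℚ (e * e * (d * e + 1) * F)) (ℕ→ℚ-+ (H * F) _) ⟩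
    ℕ→ℚ (H * F) ℚ.+ ℕ→ℚ (e * e * (d * e + 1) * F) ℚ.- ℕ→ℚ (e * e * (d * e + 1) * F)
      ≡⟨ solve 2 (λ x y → x :+ y :- y := x) refl (ℕ→ℚ (H * F)) (ℕ→ℚ (e * e * (d * e + 1) * F)) ⟩
    ℕ→ℚ (H * F) ∎
    where
    open ℚ.≤-Reasoning
    open +-*-Solver
    eq₁ : ℕ→ℚ 2 ℚ.* ℕ→ℚ d ℚ.* ℕ→ℚ ((e !) ^ d) ≡ ℕ→ℚ (2 * d * (e !) ^ d)
    eq₁ = sym (trans (ℕ→ℚ-* (2 * d) ((e !) ^ d)) (cong (ℚ._* ℕ→ℚ ((e !) ^ d)) (ℕ→ℚ-* 2 d)))
    eq₂ : ℕ→ℚ (e * e) ℚ.* (ℕ→ℚ d ℚ.* ℕ→ℚ e ℚ.+ ℤ.+ 1 / d ℚ.* ℕ→ℚ d) ℚ.* ℕ→ℚ F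
        ≡ ℕ→ℚ (e * e * (d * e + 1) * F)
    eq₂ = sym (trans (ℕ→ℚ-* (e * e * (d * e + 1)) F) (cong (ℚ._* ℕ→ℚ F)
      (trans (ℕ→ℚ-* (e * e) (d * e + 1)) (cong (ℕ→ℚ (e * e) ℚ.*_)
        (trans (ℕ→ℚ-+ (d * e) 1) (cong₂ ℚ._+_ (ℕ→ℚ-* d e) (sym (unit-fraction d))))))))

  -- As `yNum d` is the number of arrays T, this turns the threshold condition into T d r < t B,
  -- with B the number of bad arrays.
  yDen≤#bad : yDen d ℚ.≤ ℕ→ℚ #bad
  yDen≤#bad = ℚ.*-cancelˡ-≤-pos (ℕ→ℚ d) {{ℚ.positive (ℕ→ℚ-mono-< {0} {d} (s≤s z≤n))}} (begin
    ℕ→ℚ d ℚ.* (ℕ→ℚ N ℚ.* yFactor d)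
      ≡⟨ solve 3 (λ a b c → a :* (b :* c) := b :* (a :* c)) refl (ℕ→ℚ d) (ℕ→ℚ N) (yFactor d) ⟩
    ℕ→ℚ N ℚ.* (ℕ→ℚ d ℚ.* yFactor d)
      ≤⟨ *-mono (ℕ→ℚ N) (0≤ℕ→ℚ N) d*yFactor≤ ⟩
    ℕ→ℚ N ℚ.* ℕ→ℚ (H * F)
      ≡⟨ ℕ→ℚ-* N (H * F) ⟨
    ℕ→ℚ (N * (H * F))
      ≤⟨ ℕ→ℚ-mono-≤ N*H*F≤d*#bad ⟩
    ℕ→ℚ (d * #bad)
      ≡⟨ ℕ→ℚ-* d #bad ⟩
    ℕ→ℚ d ℚ.* ℕ→ℚ #bad ∎)
    where
    open ℚ.≤-Reasoning
    open +-*-Solver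

  above-threshold⇒unpackable : ∀ t → 1 ≤ t → AboveThreshold d t → ¬ PackingProperty (K d t) k
  above-threshold⇒unpackable t 1≤t (r , (0<r , n , M<E) , small) =
    unpackable t (M^d*[T∸B]^t<T^t {k !} {d} {t} {(k !) ^ d} {#bad} {r} {n} (s≤s z≤n)
      (subst (#bad ≤_) #good+#bad (m≤n+m #bad #good)) (m^n>0 (k !) {{k !≢0}} d) 1≤t 0<r M<E
      (ℚ.<-≤-trans small (*-mono (ℕ→ℚ t) (0≤ℕ→ℚ t) yDen≤#bad)))

theorem3 : (d t : ℕ) → 2 ≤ d → 1 ≤ t → AboveThreshold d t → χc⋆≥ (K d t) (2 * d ∸ 1)
theorem3 d@(suc (suc f)) t (s≤s (s≤s _)) 1≤t above k 1≤k pack =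
  -- A value k below 2d - 1 is at most 2d - 2, so the packing property would pass up to 2d - 2
  -- colours.
  decidable-stable (2 * d ∸ 1 ≤? k) λ k≱ →
    above-threshold⇒unpackable f t 1≤t above (PackingProperty-mono 1≤k (≤-pred (≰⇒> k≱)) pack)
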